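{- Let $n\ge3$ and $1<\alpha\le\sqrt2$. Then the set of minimal vectors of $D_n^\alpha$ is $S(D_n^\alpha)=\{\pm\mathbf{b}_1,\dots,\pm\mathbf{b}_n\}$. In particular $\lambda_1^2(D_n^\alpha)=2$ and $D_n^\alpha$ is generic well-rounded.
   Context: Let $\mathbf{e}_1,\dots,\mathbf{e}_n$ be the standard basis of $\mathbb{R}^n$. For $n\ge3$, $1\le\alpha\le\sqrt2$ and $\overline\alpha:=\sqrt{2-\alpha^2}$, $D_n^\alpha$ is the lattice with basis $\mathbf{b}_1=\alpha\mathbf{e}_1+\overline\alpha\mathbf{e}_2$, $\mathbf{b}_2=\alpha\mathbf{e}_2+\overline\alpha\mathbf{e}_3$, $\mathbf{b}_3=\overline\alpha\mathbf{e}_1+\alpha\mathbf{e}_3$, $\mathbf{b}_4=\overline\alpha\mathbf{e}_3-\alpha\mathbf{e}_4$, and $\mathbf{b}_k=\overline\alpha\mathbf{e}_{k-1}-\alpha\mathbf{e}_k$ for $5\le k\le n$. $S(\Lambda)$ is the set of vectors of $\Lambda$ of norm $\lambda_1(\Lambda)=\min_{0\ne\mathbf{x}\in\Lambda}\|\mathbf{x}\|$. A lattice in $\mathbb{R}^n$ is generic well-rounded if $S(\Lambda)$ spans $\mathbb{R}^n$ and $|S(\Lambda)|=2n$. -}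

module Defs where

open import Algebra.Bundles.Raw using (RawMonoid)
import Algebra.Definitions.RawMonoid as RawMonoidDefinitions
open import Data.Bool.Base using (if_then_else_)
open import Data.Fin.Base using (Fin; toℕ)
open import Data.Integer.Base as ℤ using (ℤ; +_; -[1+_])
import Data.Integer.Properties as ℤₚ
open import Data.Nat.Base as ℕ using (ℕ; zero; suc)
import Data.Nat.Properties as ℕₚ
open import Data.Product using (Σ; Σ-syntax; ∃; ∃-syntax; _×_; _,_; proj₁; proj₂)
open import Data.Rational.Base as ℚ using (ℚ; mkℚ; 0ℚ; 1ℚ; ½; ∣_∣)
import Data.Rational.Properties as ℚₚ
import Data.Rational.Unnormalised.Base as ℚᵘ
import Data.Rational.Unnormalised.Properties as ℚᵘₚ
open import Data.Rational.Solver using (module +-*-Solver)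
open import Data.Sum.Base using (_⊎_; inj₁; inj₂)
open import Data.Vec.Functional using (Vector)
import Data.Vec.Functional.Relation.Binary.Equality.Setoid as VectorEquality
open import Function.Bundles using (Bijection)
open import Level using (0ℓ)
open import Relation.Binary.Bundles using (Setoid)
import Relation.Binary.Construct.On as On
open import Relation.Binary.PropositionalEquality
  using (_≡_; refl; sym; trans; cong; cong₂; subst; subst₂)
import Relation.Binary.PropositionalEquality as ≡
open import Relation.Nullary using (¬_; Dec; yes; no; does; contradiction)
open import Relation.Unary using (Pred; _∈_; _≐_)

------------------------------------------------------------------------
-- Rational arithmetic used to show that the real operations are
-- well defined

module RationalLemmas where

  open import Data.Rational.Base using (_+_; _*_; _-_; -_; _≤_; _<_; 1/_)
  open +-*-Solver using (solve; _:+_; _:*_; :-_; _:-_; _:=_; con)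

  ½-pos : ∀ {ε} → 0ℚ < ε → 0ℚ < ½ * ε
  ½-pos {ε} 0<ε = subst (_< ½ * ε) (ℚₚ.*-zeroʳ ½) (ℚₚ.*-monoʳ-<-pos ½ 0<ε)

  ½+½ : ∀ ε → ½ * ε + ½ * ε ≡ ε
  ½+½ ε = trans (sym (ℚₚ.*-distribʳ-+ ε ½ ½)) (ℚₚ.*-identityˡ ε)

  ∣p-p∣≡0 : ∀ p → ∣ p - p ∣ ≡ 0ℚ
  ∣p-p∣≡0 p = cong ∣_∣ (ℚₚ.+-inverseʳ p)

  ∣p-q∣≡∣q-p∣ : ∀ p q → ∣ p - q ∣ ≡ ∣ q - p ∣
  ∣p-q∣≡∣q-p∣ p q = trans (sym (ℚₚ.∣-p∣≡∣p∣ (p - q)))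
    (cong ∣_∣ (solve 2 (λ a b → :- (a :- b) := b :- a) refl p q))

  triangle : ∀ p q r → ∣ p - r ∣ ≤ ∣ p - q ∣ + ∣ q - r ∣
  triangle p q r = subst (λ t → ∣ t ∣ ≤ ∣ p - q ∣ + ∣ q - r ∣)
    (solve 3 (λ a b c → (a :- b) :+ (b :- c) := a :- c) refl p q r)
    (ℚₚ.∣p+q∣≤∣p∣+∣q∣ (p - q) (q - r))

  halves : ∀ {a b ε} → a < ½ * ε → b < ½ * ε → a + b < ε
  halves {a} {b} {ε} a< b< = subst (a + b <_) (½+½ ε) (ℚₚ.+-mono-< a< b<)

  ∣+-∣ : ∀ a b c d → ∣ (a + b) - (c + d) ∣ ≤ ∣ a - c ∣ + ∣ b - d ∣
  ∣+-∣ a b c d = subst (λ t → ∣ t ∣ ≤ ∣ a - c ∣ + ∣ b - d ∣)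
    (solve 4 (λ a b c d → (a :- c) :+ (b :- d) := (a :+ b) :- (c :+ d)) refl a b c d)
    (ℚₚ.∣p+q∣≤∣p∣+∣q∣ (a - c) (b - d))

  ∣neg∣ : ∀ a b → ∣ - a - - b ∣ ≡ ∣ a - b ∣
  ∣neg∣ a b = trans (cong ∣_∣ (solve 2 (λ a b → :- a :- :- b := b :- a) refl a b))
                    (∣p-q∣≡∣q-p∣ b a)

  private
    ∣*∣-mono : ∀ {u v A δ} → ∣ u ∣ ≤ A → ∣ v ∣ ≤ δ → ∣ u * v ∣ ≤ A * δ
    ∣*∣-mono {u} {v} {A} {δ} u≤ v≤ = ℚₚ.≤-trans
      (ℚₚ.≤-reflexive (ℚₚ.∣p*q∣≡∣p∣*∣q∣ u v))
      (ℚₚ.≤-trans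
        (ℚₚ.*-monoˡ-≤-nonNeg ∣ u ∣ {{ℚₚ.∣-∣-nonNeg u}} v≤)
        (ℚₚ.*-monoʳ-≤-nonNeg δ {{ℚ.nonNegative (ℚₚ.≤-trans (ℚₚ.0≤∣p∣ v) v≤)}} u≤))

  fraction : ∀ {A ε} → 0ℚ < A → 0ℚ < ε → ∃[ δ ] 0ℚ < δ × A * δ ≡ ε
  fraction {A} {ε} 0<A 0<ε = (1/ A) * ε , pos , eq
    where
    instance
      A-pos = ℚ.positive 0<A
      A≢0   = ℚₚ.pos⇒nonZero A
    pos : 0ℚ < (1/ A) * ε
    pos = subst (_< (1/ A) * ε) (ℚₚ.*-zeroʳ (1/ A))
            (ℚₚ.*-monoʳ-<-pos (1/ A) {{ℚₚ.1/pos⇒pos A}} 0<ε)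
    eq : A * ((1/ A) * ε) ≡ ε
    eq = trans (sym (ℚₚ.*-assoc A (1/ A) ε))
           (trans (cong (_* ε) (ℚₚ.*-inverseʳ A)) (ℚₚ.*-identityˡ ε))

  product-close : ∀ {a b c d A B δ₁ δ₂ ε} →
    ∣ a ∣ ≤ A → ∣ d ∣ ≤ B → A * δ₁ ≡ ½ * (½ * ε) → B * δ₂ ≡ ½ * (½ * ε) →
    0ℚ < ε → ∣ b - d ∣ < δ₁ → ∣ a - c ∣ < δ₂ → ∣ a * b - c * d ∣ < ε
  product-close {a} {b} {c} {d} {A} {B} {δ₁} {δ₂} {ε} a≤ d≤ eq₁ eq₂ 0<ε bd ac =
    ℚₚ.≤-<-trans
      (subst (λ t → ∣ t ∣ ≤ ∣ a * (b - d) ∣ + ∣ d * (a - c) ∣)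
        (solve 4 (λ a b c d → a :* (b :- d) :+ d :* (a :- c) := a :* b :- c :* d)
          refl a b c d)
        (ℚₚ.∣p+q∣≤∣p∣+∣q∣ (a * (b - d)) (d * (a - c))))
      (halves (small eq₁ (∣*∣-mono a≤ (ℚₚ.<⇒≤ bd))) (small eq₂ (∣*∣-mono d≤ (ℚₚ.<⇒≤ ac))))
    where
    ¼<½ : ½ * (½ * ε) < ½ * ε
    ¼<½ = subst₂ _<_ (ℚₚ.+-identityʳ _) (½+½ (½ * ε))
            (ℚₚ.+-monoʳ-< (½ * (½ * ε)) (½-pos (½-pos 0<ε)))
    small : ∀ {t s} → s ≡ ½ * (½ * ε) → t ≤ s → t < ½ * ε
    small eq t≤ = ℚₚ.≤-<-trans (ℚₚ.≤-trans t≤ (ℚₚ.≤-reflexive eq)) ¼<½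

  square-mono : ∀ {p q} → 0ℚ ≤ p → p ≤ q → p * p ≤ q * q
  square-mono {p} {q} 0≤p p≤q = ℚₚ.≤-trans
    (ℚₚ.*-monoˡ-≤-nonNeg p {{ℚ.nonNegative 0≤p}} p≤q)
    (ℚₚ.*-monoʳ-≤-nonNeg q {{ℚ.nonNegative (ℚₚ.≤-trans 0≤p p≤q)}} p≤q)

  ∣∣<-intro : ∀ {p q ε} → p < q + ε → q < p + ε → ∣ p - q ∣ < ε
  ∣∣<-intro {p} {q} {ε} p< q< with ℚₚ.∣p∣≡p∨∣p∣≡-p (p - q)
  ... | inj₁ eq = subst₂ _<_ (sym eq)
        (solve 2 (λ q e → (q :+ e) :- q := e) refl q ε)
        (ℚₚ.+-monoˡ-< (- q) p<)
  ... | inj₂ eq = subst₂ _<_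
        (trans (solve 2 (λ p q → q :- p := :- (p :- q)) refl p q) (sym eq))
        (solve 2 (λ p e → (p :+ e) :- p := e) refl p ε)
        (ℚₚ.+-monoˡ-< (- p) q<)

  ∣∣<-elim : ∀ {p q ε} → ∣ p - q ∣ < ε → p < q + ε
  ∣∣<-elim {p} {q} {ε} h = subst₂ _<_
    (solve 2 (λ p q → q :+ (p :- q) := p) refl p q) refl
    (ℚₚ.+-monoʳ-< q (ℚₚ.≤-<-trans (p≤∣p∣ (p - q)) h))
    where
    p≤∣p∣ : ∀ r → r ≤ ∣ r ∣
    p≤∣p∣ r with ℚₚ.≤-total 0ℚ r
    ... | inj₁ 0≤r = ℚₚ.≤-reflexive (sym (ℚₚ.0≤p⇒∣p∣≡p 0≤r))
    ... | inj₂ r≤0 = ℚₚ.≤-trans r≤0 (ℚₚ.0≤∣p∣ r)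

  fromℚᵘ-homo-+ : ∀ p q → ℚ.fromℚᵘ (p ℚᵘ.+ q) ≡ ℚ.fromℚᵘ p + ℚ.fromℚᵘ q
  fromℚᵘ-homo-+ p q = ℚₚ.toℚᵘ-injective (ℚᵘₚ.≃-trans (ℚₚ.toℚᵘ-fromℚᵘ (p ℚᵘ.+ q))
    (ℚᵘₚ.≃-sym (ℚᵘₚ.≃-trans (ℚₚ.toℚᵘ-homo-+ (ℚ.fromℚᵘ p) (ℚ.fromℚᵘ q))
      (ℚᵘₚ.+-cong (ℚₚ.toℚᵘ-fromℚᵘ p) (ℚₚ.toℚᵘ-fromℚᵘ q)))))

  fromℚᵘ-homo-* : ∀ p q → ℚ.fromℚᵘ (p ℚᵘ.* q) ≡ ℚ.fromℚᵘ p * ℚ.fromℚᵘ q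
  fromℚᵘ-homo-* p q = ℚₚ.toℚᵘ-injective (ℚᵘₚ.≃-trans (ℚₚ.toℚᵘ-fromℚᵘ (p ℚᵘ.* q))
    (ℚᵘₚ.≃-sym (ℚᵘₚ.≃-trans (ℚₚ.toℚᵘ-homo-* (ℚ.fromℚᵘ p) (ℚ.fromℚᵘ q))
      (ℚᵘₚ.*-cong (ℚₚ.toℚᵘ-fromℚᵘ p) (ℚₚ.toℚᵘ-fromℚᵘ q)))))

  fromℚᵘ-mono-≤ : ∀ {p q} → p ℚᵘ.≤ q → ℚ.fromℚᵘ p ≤ ℚ.fromℚᵘ q
  fromℚᵘ-mono-≤ {p} {q} p≤q = ℚₚ.toℚᵘ-cancel-≤
    (ℚᵘₚ.≤-respˡ-≃ (ℚᵘₚ.≃-sym (ℚₚ.toℚᵘ-fromℚᵘ p))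
      (ℚᵘₚ.≤-respʳ-≃ (ℚᵘₚ.≃-sym (ℚₚ.toℚᵘ-fromℚᵘ q)) p≤q))

  ι : ℕ → ℚ
  ι n = + n ℚ./ 1

  unit : ℕ → ℚ
  unit n = + 1 ℚ./ suc n

  ι-suc : ∀ n → ι (suc n) ≡ 1ℚ + ι n
  ι-suc n = trans
    (ℚₚ.fromℚᵘ-cong {ℚᵘ.mkℚᵘ (+ suc n) 0} {ℚᵘ.mkℚᵘ (+ 1) 0 ℚᵘ.+ ℚᵘ.mkℚᵘ (+ n) 0}
      (ℚᵘ.*≡* (cong (ℤ._* (+ 1)) (cong (λ t → + 1 ℤ.+ t) (sym (ℤₚ.*-identityʳ (+ n)))))))
    (fromℚᵘ-homo-+ (ℚᵘ.mkℚᵘ (+ 1) 0) (ℚᵘ.mkℚᵘ (+ n) 0))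

  ι-* : ∀ m n → ι (m ℕ.* n) ≡ ι m * ι n
  ι-* m n = trans
    (ℚₚ.fromℚᵘ-cong {ℚᵘ.mkℚᵘ (+ (m ℕ.* n)) 0} {ℚᵘ.mkℚᵘ (+ m) 0 ℚᵘ.* ℚᵘ.mkℚᵘ (+ n) 0}
      (ℚᵘ.*≡* (cong (ℤ._* (+ 1)) (ℤₚ.pos-* m n))))
    (fromℚᵘ-homo-* (ℚᵘ.mkℚᵘ (+ m) 0) (ℚᵘ.mkℚᵘ (+ n) 0))

  ι-unit : ∀ n → ι (suc n) * unit n ≡ 1ℚ
  ι-unit n = trans (sym (fromℚᵘ-homo-* (ℚᵘ.mkℚᵘ (+ suc n) 0) (ℚᵘ.mkℚᵘ (+ 1) n)))
    (ℚₚ.fromℚᵘ-cong {ℚᵘ.mkℚᵘ (+ suc n) 0 ℚᵘ.* ℚᵘ.mkℚᵘ (+ 1) n} {ℚᵘ.mkℚᵘ (+ 1) 0}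
      (ℚᵘ.*≡* (trans (cong (ℤ._* + 1) (ℤₚ.*-comm (+ suc n) (+ 1)))
        (ℤₚ.*-comm (+ 1 ℤ.* + suc n) (+ 1)))))

  unit-pos : ∀ n → 0ℚ < unit n
  unit-pos n = ℚₚ.positive⁻¹ (unit n) {{ℚₚ.normalize-pos 1 (suc n)}}

  unit-antitone : ∀ {m n} → m ℕ.≤ n → unit n ≤ unit m
  unit-antitone {m} {n} m≤n = fromℚᵘ-mono-≤ {ℚᵘ.mkℚᵘ (+ 1) n} {ℚᵘ.mkℚᵘ (+ 1) m}
    (ℚᵘ.*≤* (ℤₚ.*-monoˡ-≤-nonNeg (+ 1) (ℤ.+≤+ (ℕ.s≤s m≤n))))

  archimedean : ∀ {ε} → 0ℚ < ε → ∃[ N ] unit N ≤ ε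
  archimedean {mkℚ (+ suc p) d c} _ = d ,
    subst (unit d ≤_) (ℚₚ.fromℚᵘ-toℚᵘ (mkℚ (+ suc p) d c))
      (fromℚᵘ-mono-≤ {ℚᵘ.mkℚᵘ (+ 1) d} {ℚᵘ.mkℚᵘ (+ suc p) d}
        (ℚᵘ.*≤* (ℤₚ.*-monoʳ-≤-nonNeg (+ suc d) (ℤ.+≤+ (ℕ.s≤s (ℕ.z≤n {p}))))))
  archimedean {mkℚ (+ 0) d c} (ℚ.*<* (ℤ.+<+ ()))
  archimedean {mkℚ -[1+ p ] d c} (ℚ.*<* ())

  bounded : ∀ q → q ≤ ι ℤ.∣ ℚ.numerator q ∣
  bounded q@(mkℚ p d c) =
    subst (_≤ ι ℤ.∣ p ∣) (ℚₚ.fromℚᵘ-toℚᵘ q)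
      (fromℚᵘ-mono-≤ {ℚᵘ.mkℚᵘ p d} {ℚᵘ.mkℚᵘ (+ ℤ.∣ p ∣) 0} (ℚᵘ.*≤* (h p)))
    where
    h : ∀ p → p ℤ.* + 1 ℤ.≤ + ℤ.∣ p ∣ ℤ.* + suc d
    h (+ n)    = ℤₚ.*-monoˡ-≤-nonNeg (+ n) (ℤ.+≤+ (ℕ.s≤s (ℕ.z≤n {d})))
    h -[1+ n ] = ℤ.-≤+

------------------------------------------------------------------------
-- Rational approximation of square roots

-- √≈ q n is the largest multiple of 1/(n+1) whose square is at most
-- max(q,0).  It is found by counting upwards; the number of steps is
-- large enough because ∣↥ q∣ + 1 exceeds √q.

module RationalRoot where

  open import Data.Rational.Base using (_+_; _*_; _-_; -_; _≤_; _<_)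
  open +-*-Solver using (solve; _:+_; _:*_; :-_; _:-_; _:=_; con)
  open RationalLemmas

  climb : ℚ → ℚ → ℕ → ℚ
  climb q ε zero    = 0ℚ
  climb q ε (suc j) =
    let r = climb q ε j in
    if does ((r + ε) * (r + ε) ℚₚ.≤? q) then r + ε else r

  steps : ℚ → ℕ → ℕ
  steps q n = suc n ℕ.* suc ℤ.∣ ℚ.numerator q ∣

  opaque
    √≈ : ℚ → ℕ → ℚ
    √≈ q n = climb q (unit n) (steps q n)

  private
    record Invariant (q ε : ℚ) (j : ℕ) (r : ℚ) : Set where
      field
        nonneg : 0ℚ ≤ r
        lower  : r ≡ 0ℚ ⊎ r * r ≤ q
        upper  : q < (r + ε) * (r + ε) ⊎ r ≡ ι j * ε

    invariant-step : ∀ {q ε j r} → 0ℚ < ε → Invariant q ε j r →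
      (d : Dec ((r + ε) * (r + ε) ≤ q)) →
      Invariant q ε (suc j) (if does d then r + ε else r)
    invariant-step 0<ε inv (no ≰q) = record
      { nonneg = Invariant.nonneg inv
      ; lower  = Invariant.lower inv
      ; upper  = inj₁ (ℚₚ.≰⇒> ≰q)
      }
    invariant-step {q} {ε} {j} {r} 0<ε inv (yes ≤q) = record
      { nonneg = ℚₚ.≤-trans (Invariant.nonneg inv)
                   (subst (_≤ r + ε) (ℚₚ.+-identityʳ r) (ℚₚ.+-monoʳ-≤ r (ℚₚ.<⇒≤ 0<ε)))
      ; lower  = inj₂ ≤q
      ; upper  = inj₂ (next (Invariant.upper inv))
      }
      where
      next : q < (r + ε) * (r + ε) ⊎ r ≡ ι j * ε → r + ε ≡ ι (suc j) * ε
      next (inj₁ q<) = contradiction (ℚₚ.<-≤-trans q< ≤q) (ℚₚ.<-irrefl refl)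
      next (inj₂ eq) = trans (cong (_+ ε) eq)
        (trans (solve 2 (λ i e → i :* e :+ e := (con 1ℚ :+ i) :* e) refl (ι j) ε)
          (cong (_* ε) (sym (ι-suc j))))

    invariant : ∀ q {ε} → 0ℚ < ε → ∀ j → Invariant q ε j (climb q ε j)
    invariant q {ε} 0<ε zero = record
      { nonneg = ℚₚ.≤-refl
      ; lower  = inj₁ refl
      ; upper  = inj₂ (sym (ℚₚ.*-zeroˡ ε))
      }
    invariant q {ε} 0<ε (suc j) =
      invariant-step 0<ε (invariant q 0<ε j)
        ((climb q ε j + ε) * (climb q ε j + ε) ℚₚ.≤? q)

    opaque
      unfolding √≈
      √≈-invariant : ∀ q n → Invariant q (unit n) (steps q n) (√≈ q n)
      √≈-invariant q n = invariant q (unit-pos n) (steps q n)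

  √≈-nonneg : ∀ q n → 0ℚ ≤ √≈ q n
  √≈-nonneg q n = Invariant.nonneg (√≈-invariant q n)

  √≈-lower : ∀ q n → √≈ q n ≡ 0ℚ ⊎ √≈ q n * √≈ q n ≤ q
  √≈-lower q n = Invariant.lower (√≈-invariant q n)

  √≈-upper : ∀ q n → q < (√≈ q n + unit n) * (√≈ q n + unit n)
  √≈-upper q n = result (Invariant.upper (√≈-invariant q n))
    where
    k = ℤ.∣ ℚ.numerator q ∣
    r = √≈ q n
    M = ι (suc k)

    0≤ιk : 0ℚ ≤ ι k
    0≤ιk = ℚₚ.nonNegative⁻¹ (ι k) {{ℚₚ.normalize-nonNeg k 1}}
    1≤M : 1ℚ ≤ M
    1≤M = subst₂ _≤_ (ℚₚ.+-identityʳ 1ℚ) (sym (ι-suc k)) (ℚₚ.+-monoʳ-≤ 1ℚ 0≤ιk)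
    0≤M : 0ℚ ≤ M
    0≤M = ℚₚ.nonNegative⁻¹ M {{ℚₚ.normalize-nonNeg (suc k) 1}}
    q<M : q < M
    q<M = subst₂ _<_ (ℚₚ.+-identityˡ q) (sym (ι-suc k))
            (ℚₚ.+-mono-<-≤ (ℚₚ.positive⁻¹ 1ℚ) (bounded q))
    M≤M² : M ≤ M * M
    M≤M² = subst (_≤ M * M) (ℚₚ.*-identityʳ M)
             (ℚₚ.*-monoˡ-≤-nonNeg M {{ℚ.nonNegative 0≤M}} 1≤M)

    last≡M : ι (steps q n) * unit n ≡ M
    last≡M = trans (cong (_* unit n) (ι-* (suc n) (suc k)))
      (trans (solve 3 (λ a b c → a :* b :* c := (a :* c) :* b) refl (ι (suc n)) M (unit n))
        (trans (cong (_* M) (ι-unit n)) (ℚₚ.*-identityˡ M)))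

    result : q < (r + unit n) * (r + unit n) ⊎ r ≡ ι (steps q n) * unit n →
             q < (r + unit n) * (r + unit n)
    result (inj₁ q<) = q<
    result (inj₂ eq) = ℚₚ.<-≤-trans q<M (ℚₚ.≤-trans M≤M² (square-mono 0≤M
      (subst (_≤ r + unit n) (trans (ℚₚ.+-identityʳ r) (trans eq last≡M))
        (ℚₚ.+-monoʳ-≤ r (ℚₚ.<⇒≤ (unit-pos n))))))

  √≈-continuous : ∀ {p q ε m n} → 0ℚ < ε →
    unit n ≤ ½ * ε → ∣ p - q ∣ < (½ * ε) * (½ * ε) → √≈ p m < √≈ q n + ε
  √≈-continuous {p} {q} {ε} {m} {n} 0<ε un≤ close
    with √≈ q n + ε ℚₚ.≤? √≈ p m
  ... | no  ≰ = ℚₚ.≰⇒> ≰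
  ... | yes s+ε≤r = contradiction p<p (ℚₚ.<-irrefl refl)
    where
    r = √≈ p m
    s = √≈ q n
    h = ½ * ε
    0<h = ½-pos 0<ε
    0≤s+u : 0ℚ ≤ s + unit n
    0≤s+u = subst (_≤ s + unit n) (ℚₚ.+-identityˡ 0ℚ)
              (ℚₚ.+-mono-≤ (√≈-nonneg q n) (ℚₚ.<⇒≤ (unit-pos n)))
    0≤s+h : 0ℚ ≤ s + h
    0≤s+h = ℚₚ.≤-trans 0≤s+u (ℚₚ.+-monoʳ-≤ s un≤)
    s+h+h≤r : (s + h) + h ≤ r
    s+h+h≤r = subst (_≤ r)
      (trans (cong (λ t → s + t) (sym (½+½ ε))) (sym (ℚₚ.+-assoc s h h))) s+ε≤r
    0<r : 0ℚ < r
    0<r = ℚₚ.<-≤-trans (subst (_< (s + h) + h) (ℚₚ.+-identityˡ 0ℚ)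
            (ℚₚ.+-mono-≤-< 0≤s+h 0<h)) s+h+h≤r
    r²≤p : r * r ≤ p
    r²≤p with √≈-lower p m
    ... | inj₁ r≡0 = contradiction 0<r (ℚₚ.<-irrefl (sym r≡0))
    ... | inj₂ le  = le
    q<sh² : q < (s + h) * (s + h)
    q<sh² = ℚₚ.<-≤-trans (√≈-upper q n) (square-mono 0≤s+u (ℚₚ.+-monoʳ-≤ s un≤))
    0≤cross : 0ℚ ≤ (s + h) * h
    0≤cross = subst (_≤ (s + h) * h) (ℚₚ.*-zeroˡ h)
      (ℚₚ.*-monoʳ-≤-nonNeg h {{ℚ.nonNegative (ℚₚ.<⇒≤ 0<h)}} 0≤s+h)
    expand : (s + h) * (s + h) + h * h ≤ ((s + h) + h) * ((s + h) + h)
    expand = subst₂ _≤_ (ℚₚ.+-identityʳ _)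
      (solve 2 (λ a b → (a :* a :+ b :* b) :+ (a :* b :+ a :* b) := (a :+ b) :* (a :+ b))
        refl (s + h) h)
      (ℚₚ.+-monoʳ-≤ ((s + h) * (s + h) + h * h)
        (subst (_≤ (s + h) * h + (s + h) * h) (ℚₚ.+-identityˡ 0ℚ)
          (ℚₚ.+-mono-≤ 0≤cross 0≤cross)))
    0≤s+h+h : 0ℚ ≤ (s + h) + h
    0≤s+h+h = subst (_≤ (s + h) + h) (ℚₚ.+-identityˡ 0ℚ)
      (ℚₚ.+-mono-≤ 0≤s+h (ℚₚ.<⇒≤ 0<h))
    p<p : p < p
    p<p = ℚₚ.<-≤-trans (∣∣<-elim close)
      (ℚₚ.≤-trans (ℚₚ.+-monoˡ-≤ (h * h) (ℚₚ.<⇒≤ q<sh²))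
        (ℚₚ.≤-trans expand
          (ℚₚ.≤-trans (square-mono 0≤s+h+h s+h+h≤r) r²≤p)))

------------------------------------------------------------------------
-- The real numbers: Cauchy sequences of rationals modulo null sequences.
-- Every ∃[ N ] is data, so moduli of convergence are carried explicitly;
-- x < y means that x and y are eventually separated by a positive rational.

IsCauchy : (ℕ → ℚ) → Set
IsCauchy s = ∀ ε → 0ℚ ℚ.< ε →
  ∃[ N ] (∀ m n → N ℕ.≤ m → N ℕ.≤ n → ∣ s m ℚ.- s n ∣ ℚ.< ε)

record ℝ : Set where
  constructor mkℝ
  field
    seq    : ℕ → ℚ
    cauchy : IsCauchy seq

open ℝ public

infix 4 _≃_ _≤_ _<_

_≃_ : ℝ → ℝ → Set
x ≃ y = ∀ ε → 0ℚ ℚ.< ε → ∃[ N ] (∀ n → N ℕ.≤ n → ∣ seq x n ℚ.- seq y n ∣ ℚ.< ε)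

_≤_ : ℝ → ℝ → Set
x ≤ y = ∀ ε → 0ℚ ℚ.< ε → ∃[ N ] (∀ n → N ℕ.≤ n → seq x n ℚ.< seq y n ℚ.+ ε)

_<_ : ℝ → ℝ → Set
x < y = ∃[ ε ] 0ℚ ℚ.< ε × ∃[ N ] (∀ n → N ℕ.≤ n → seq x n ℚ.+ ε ℚ.< seq y n)

module CauchyLemmas where

  open RationalLemmas
  open RationalRoot

  Bounded : (ℕ → ℚ) → Set
  Bounded s = ∃[ B ] 0ℚ ℚ.< B × ∃[ N ] (∀ n → N ℕ.≤ n → ∣ s n ∣ ℚ.≤ B)

  opaque

    const-isCauchy : ∀ q → IsCauchy (λ _ → q)
    const-isCauchy q ε 0<ε = 0 , λ _ _ _ _ → subst (ℚ._< ε) (sym (∣p-p∣≡0 q)) 0<ε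

    +-isCauchy : ∀ s t → IsCauchy s → IsCauchy t → IsCauchy (λ n → s n ℚ.+ t n)
    +-isCauchy s t s-cauchy t-cauchy ε 0<ε =
      let N₁ , h₁ = s-cauchy (½ ℚ.* ε) (½-pos 0<ε)
          N₂ , h₂ = t-cauchy (½ ℚ.* ε) (½-pos 0<ε)
      in N₁ ℕ.⊔ N₂ , λ m n m≥ n≥ →
        ℚₚ.≤-<-trans (∣+-∣ (s m) (t m) (s n) (t n))
          (halves {ε = ε}
            (h₁ m n (ℕₚ.m⊔n≤o⇒m≤o N₁ N₂ m≥) (ℕₚ.m⊔n≤o⇒m≤o N₁ N₂ n≥))
            (h₂ m n (ℕₚ.m⊔n≤o⇒n≤o N₁ N₂ m≥) (ℕₚ.m⊔n≤o⇒n≤o N₁ N₂ n≥)))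

    neg-isCauchy : ∀ s → IsCauchy s → IsCauchy (λ n → ℚ.- s n)
    neg-isCauchy s s-cauchy ε 0<ε =
      let N , h = s-cauchy ε 0<ε in
      N , λ m n m≥ n≥ → subst (ℚ._< ε) (sym (∣neg∣ (s m) (s n))) (h m n m≥ n≥)

    bounded-by-tail : ∀ p q → ∣ p ℚ.- q ∣ ℚ.< 1ℚ → ∣ p ∣ ℚ.≤ ∣ q ∣ ℚ.+ 1ℚ
    bounded-by-tail p q h = ℚₚ.≤-trans
      (subst (λ t → ∣ t ∣ ℚ.≤ ∣ q ∣ ℚ.+ ∣ p ℚ.- q ∣)
        (solve 2 (λ a b → b :+ (a :- b) := a) refl p q)
        (ℚₚ.∣p+q∣≤∣p∣+∣q∣ q (p ℚ.- q)))
      (ℚₚ.+-monoʳ-≤ ∣ q ∣ (ℚₚ.<⇒≤ h))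
      where open +-*-Solver

    isCauchy⇒bounded : ∀ s → IsCauchy s → Bounded s
    isCauchy⇒bounded s s-cauchy =
      let N , close = s-cauchy 1ℚ (ℚₚ.positive⁻¹ 1ℚ) in
      ∣ s N ∣ ℚ.+ 1ℚ ,
      subst (ℚ._< ∣ s N ∣ ℚ.+ 1ℚ) (ℚₚ.+-identityˡ 0ℚ)
        (ℚₚ.+-mono-≤-< (ℚₚ.0≤∣p∣ (s N)) (ℚₚ.positive⁻¹ 1ℚ)) ,
      N , λ n N≤n → bounded-by-tail (s n) (s N) (close n N N≤n ℕₚ.≤-refl)

    *-isCauchy′ : ∀ s t → IsCauchy s → IsCauchy t → Bounded s → Bounded t →
                  IsCauchy (λ n → s n ℚ.* t n)
    *-isCauchy′ s t s-cauchy t-cauchy (A , 0<A , Nᴬ , s≤A) (B , 0<B , Nᴮ , t≤B) ε 0<ε =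
      let δ₁ , 0<δ₁ , eq₁ = fraction 0<A (½-pos (½-pos 0<ε))
          δ₂ , 0<δ₂ , eq₂ = fraction 0<B (½-pos (½-pos 0<ε))
          N₁ , h₁ = t-cauchy δ₁ 0<δ₁
          N₂ , h₂ = s-cauchy δ₂ 0<δ₂
          l : ∀ {k} → (Nᴬ ℕ.⊔ Nᴮ) ℕ.⊔ (N₁ ℕ.⊔ N₂) ℕ.≤ k → Nᴬ ℕ.⊔ Nᴮ ℕ.≤ k
          l = ℕₚ.m⊔n≤o⇒m≤o (Nᴬ ℕ.⊔ Nᴮ) (N₁ ℕ.⊔ N₂)
          r : ∀ {k} → (Nᴬ ℕ.⊔ Nᴮ) ℕ.⊔ (N₁ ℕ.⊔ N₂) ℕ.≤ k → N₁ ℕ.⊔ N₂ ℕ.≤ k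
          r = ℕₚ.m⊔n≤o⇒n≤o (Nᴬ ℕ.⊔ Nᴮ) (N₁ ℕ.⊔ N₂)
      in (Nᴬ ℕ.⊔ Nᴮ) ℕ.⊔ (N₁ ℕ.⊔ N₂) , λ m n m≥ n≥ →
        product-close {s m} {t m} {s n} {t n} {A} {B} {δ₁} {δ₂} {ε}
          (s≤A m (ℕₚ.m⊔n≤o⇒m≤o Nᴬ Nᴮ (l m≥)))
          (t≤B n (ℕₚ.m⊔n≤o⇒n≤o Nᴬ Nᴮ (l n≥)))
          eq₁ eq₂ 0<ε
          (h₁ m n (ℕₚ.m⊔n≤o⇒m≤o N₁ N₂ (r m≥)) (ℕₚ.m⊔n≤o⇒m≤o N₁ N₂ (r n≥)))
          (h₂ m n (ℕₚ.m⊔n≤o⇒n≤o N₁ N₂ (r m≥)) (ℕₚ.m⊔n≤o⇒n≤o N₁ N₂ (r n≥)))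

    *-isCauchy : ∀ s t → IsCauchy s → IsCauchy t → IsCauchy (λ n → s n ℚ.* t n)
    *-isCauchy s t s-cauchy t-cauchy = *-isCauchy′ s t s-cauchy t-cauchy
      (isCauchy⇒bounded s s-cauchy) (isCauchy⇒bounded t t-cauchy)

    √-isCauchy : ∀ s → IsCauchy s → IsCauchy (λ n → √≈ (s n) n)
    √-isCauchy s s-cauchy ε 0<ε =
      let 0<h = ½-pos {ε} 0<ε
          N₁ , h = s-cauchy ((½ ℚ.* ε) ℚ.* (½ ℚ.* ε)) (ℚₚ.positive⁻¹ _
            {{ℚₚ.pos*pos⇒pos (½ ℚ.* ε) {{ℚ.positive 0<h}} (½ ℚ.* ε) {{ℚ.positive 0<h}}}})
          N₂ , u≤ = archimedean 0<h
          near : ∀ m n → N₁ ℕ.⊔ N₂ ℕ.≤ m → N₁ ℕ.⊔ N₂ ℕ.≤ n →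
                 √≈ (s m) m ℚ.< √≈ (s n) n ℚ.+ ε
          near m n m≥ n≥ = √≈-continuous {s m} {s n} {ε} {m} {n} 0<ε
            (ℚₚ.≤-trans (unit-antitone (ℕₚ.m⊔n≤o⇒n≤o N₁ N₂ n≥)) u≤)
            (h m n (ℕₚ.m⊔n≤o⇒m≤o N₁ N₂ m≥) (ℕₚ.m⊔n≤o⇒m≤o N₁ N₂ n≥))
      in N₁ ℕ.⊔ N₂ , λ m n m≥ n≥ →
        ∣∣<-intro {√≈ (s m) m} {√≈ (s n) n} {ε} (near m n m≥ n≥) (near n m n≥ m≥)

open CauchyLemmas

fromℤ : ℤ → ℝ
fromℤ z = mkℝ (λ _ → z ℚ./ 1) (const-isCauchy (z ℚ./ 1))

0ℝ 1ℝ 2ℝ : ℝ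
0ℝ = fromℤ (+ 0)
1ℝ = fromℤ (+ 1)
2ℝ = fromℤ (+ 2)

infixl 6 _+_ _-_
infixl 7 _*_
infix  8 -_ √_

_+_ : ℝ → ℝ → ℝ
x + y = mkℝ (λ n → seq x n ℚ.+ seq y n) (+-isCauchy (seq x) (seq y) (cauchy x) (cauchy y))

-_ : ℝ → ℝ
- x = mkℝ (λ n → ℚ.- seq x n) (neg-isCauchy (seq x) (cauchy x))

_-_ : ℝ → ℝ → ℝ
x - y = x + - y

_*_ : ℝ → ℝ → ℝ
x * y = mkℝ (λ n → seq x n ℚ.* seq y n) (*-isCauchy (seq x) (seq y) (cauchy x) (cauchy y))

-- For x < 0 this gives 0; below, the square root is only applied to
-- nonnegative reals.
√_ : ℝ → ℝ
√ x = mkℝ (λ n → RationalRoot.√≈ (seq x n) n) (√-isCauchy (seq x) (cauchy x))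

module _ where

  open RationalLemmas

  ≃-refl : ∀ {x} → x ≃ x
  ≃-refl {x} ε 0<ε = 0 , λ n _ → subst (ℚ._< ε) (sym (∣p-p∣≡0 (seq x n))) 0<ε

  ≃-sym : ∀ {x y} → x ≃ y → y ≃ x
  ≃-sym {x} {y} x≃y ε 0<ε with x≃y ε 0<ε
  ... | N , h = N , λ n n≥ → subst (ℚ._< ε) (∣p-q∣≡∣q-p∣ (seq x n) (seq y n)) (h n n≥)

  ≃-trans : ∀ {x y z} → x ≃ y → y ≃ z → x ≃ z
  ≃-trans {x} {y} {z} x≃y y≃z ε 0<ε
    with x≃y (½ ℚ.* ε) (½-pos 0<ε) | y≃z (½ ℚ.* ε) (½-pos 0<ε)
  ... | N₁ , h₁ | N₂ , h₂ = N₁ ℕ.⊔ N₂ , λ n n≥ →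
    ℚₚ.≤-<-trans (triangle (seq x n) (seq y n) (seq z n))
      (halves {ε = ε} (h₁ n (ℕₚ.m⊔n≤o⇒m≤o N₁ N₂ n≥)) (h₂ n (ℕₚ.m⊔n≤o⇒n≤o N₁ N₂ n≥)))

+-0-rawMonoid : RawMonoid 0ℓ 0ℓ
+-0-rawMonoid = record { Carrier = ℝ ; _≈_ = _≃_ ; _∙_ = _+_ ; ε = 0ℝ }

open RawMonoidDefinitions +-0-rawMonoid public using (sum)

------------------------------------------------------------------------
-- Euclidean space

ℝ-setoid : Setoid 0ℓ 0ℓ
ℝ-setoid = record
  { Carrier       = ℝ
  ; _≈_           = _≃_
  ; isEquivalence = record
    { refl  = λ {x} → ≃-refl {x}
    ; sym   = λ {x} {y} → ≃-sym {x} {y}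
    ; trans = λ {x} {y} {z} → ≃-trans {x} {y} {z}
    }
  }

open VectorEquality ℝ-setoid public using (_≋_; ≋-setoid)

infix 8 -ᵛ_
infixl 7 _·_
infixl 6 _+ᵛ_ _-ᵛ_

_+ᵛ_ _-ᵛ_ : ∀ {n} → Vector ℝ n → Vector ℝ n → Vector ℝ n
(u +ᵛ v) i = u i + v i
(u -ᵛ v) i = u i - v i

-ᵛ_ : ∀ {n} → Vector ℝ n → Vector ℝ n
(-ᵛ v) i = - v i

_·_ : ∀ {n} → ℝ → Vector ℝ n → Vector ℝ n
(c · v) i = c * v i

0ᵛ : ∀ {n} → Vector ℝ n
0ᵛ _ = 0ℝ

‖_‖ : ∀ {n} → Vector ℝ n → ℝ
‖ x ‖ = √ sum (λ i → x i * x i)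

linearCombination : ∀ {m n} → Vector ℝ m → Vector (Vector ℝ n) m → Vector ℝ n
linearCombination c v j = sum (λ i → c i * v i j)

LinearlyIndependent : ∀ {m n} → Vector (Vector ℝ n) m → Set
LinearlyIndependent v = ∀ c → linearCombination c v ≋ 0ᵛ → ∀ i → c i ≃ 0ℝ

Spans : ∀ {n} → Pred (Vector ℝ n) 0ℓ → Set
Spans {n} P = (y : Vector ℝ n) →
  ∃[ m ] Σ[ v ∈ Vector (Vector ℝ n) m ] Σ[ c ∈ Vector ℝ m ]
    (∀ i → v i ∈ P) × y ≋ linearCombination c v

HasCardinality : ∀ {n} → Pred (Vector ℝ n) 0ℓ → ℕ → Set
HasCardinality {n} P k = Bijection (≡.setoid (Fin k))
  (On.setoid {B = Σ (Vector ℝ n) P} (≋-setoid n) proj₁)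

------------------------------------------------------------------------
-- Lattices

ℤ-span : ∀ {m n} → Vector (Vector ℝ n) m → Pred (Vector ℝ n) 0ℓ
ℤ-span {m} b x = Σ[ z ∈ Vector ℤ m ] x ≋ linearCombination (λ i → fromℤ (z i)) b

IsLattice : ∀ {n} → Pred (Vector ℝ n) 0ℓ → Set
IsLattice {n} Λ = ∃[ m ] Σ[ b ∈ Vector (Vector ℝ n) m ]
  LinearlyIndependent b × Λ ≐ ℤ-span b

-- λ₁ is given as a relation, since a least nonzero norm need not exist
-- for an arbitrary set of vectors.
IsFirstMinimum : ∀ {n} → Pred (Vector ℝ n) 0ℓ → ℝ → Set
IsFirstMinimum Λ λ₁ =
  (∃[ x ] x ∈ Λ × ¬ (x ≋ 0ᵛ) × ‖ x ‖ ≃ λ₁) ×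
  (∀ x → x ∈ Λ → ¬ (x ≋ 0ᵛ) → λ₁ ≤ ‖ x ‖)

S : ∀ {n} → Pred (Vector ℝ n) 0ℓ → Pred (Vector ℝ n) 0ℓ
S Λ x = x ∈ Λ × ∃[ λ₁ ] IsFirstMinimum Λ λ₁ × ‖ x ‖ ≃ λ₁

record GenericWellRounded {n} (Λ : Pred (Vector ℝ n) 0ℓ) : Set where
  field
    isLattice   : IsLattice Λ
    wellRounded : Spans (S Λ)
    generic     : HasCardinality (S Λ) (2 ℕ.* n)

±_ : ∀ {m n} → Vector (Vector ℝ n) m → Pred (Vector ℝ n) 0ℓ
(± b) x = ∃[ i ] (x ≋ b i ⊎ x ≋ -ᵛ b i)

------------------------------------------------------------------------
-- The lattice Dₙ^α

-- Indices start at 0, so 𝐞 k is e_{k+1} and row k below is b_{k+1}.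
-- 𝐞 k is only used with k < n.
𝐞 : ∀ {n} → ℕ → Vector ℝ n
𝐞 k i = if k ℕ.≡ᵇ toℕ i then 1ℝ else 0ℝ

basis : ∀ n → ℝ → Vector (Vector ℝ n) n
basis n α i = row (toℕ i)
  where
  ᾱ : ℝ
  ᾱ = √ (2ℝ - α * α)

  row : ℕ → Vector ℝ n
  row 0                     = α · 𝐞 0 +ᵛ ᾱ · 𝐞 1
  row 1                     = α · 𝐞 1 +ᵛ ᾱ · 𝐞 2
  row 2                     = ᾱ · 𝐞 0 +ᵛ α · 𝐞 2
  row (suc k@(suc (suc _))) = ᾱ · 𝐞 k -ᵛ α · 𝐞 (suc k)

D : ∀ n → ℝ → Pred (Vector ℝ n) 0ℓ
D n α = ℤ-span (basis n α)

{-# OPTIONS --safe #-}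
-- Put t = αᾱ and s = ᾱ².  For x = Σ zᵢ bᵢ the identity α² + ᾱ² = 2 turns the
-- Gram form into
--   ‖x‖² = 2 (1 - t) Σ zᵢ² + 2 (t - s) A(z) + 2 s D(z),
-- where A and D are integral forms not depending on α (of types Aₙ and Dₙ),
-- and 2A and 2D are sums of squares that vanish only at z = 0.  For integral
-- z ≠ 0 all three forms are at least 1, and the weights are nonnegative with
-- sum 2, so ‖x‖² ≥ 2.  Since α > 1, the weight of Σ zᵢ² is positive, so
-- equality forces Σ zᵢ² = 1, that is, x = ± bᵢ.  For real z the same identity
-- shows that the bᵢ are linearly independent.
module Submission where

open import Algebra.Bundles using (CommutativeRing)
import Algebra.Solver.Ring
open import Algebra.Solver.Ring.AlmostCommutativeRing
  using (fromCommutativeRing; -raw-almostCommutative⟶; _-Raw-AlmostCommutative⟶_)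
open import Data.Bool.Base using (if_then_else_)
open import Data.Fin.Base using (Fin; zero; suc; toℕ; remQuot; combine)
import Data.Fin.Properties as Finₚ
open import Data.Integer.Base as ℤ using (ℤ; +_; +0; +[1+_]; -[1+_])
import Data.Integer.Properties as ℤₚ
open import Data.Maybe.Base as Maybe using ()
open import Data.Nat.Base as ℕ using (ℕ; zero; suc)
import Data.Nat.Properties as ℕₚ
open import Data.Product using (Σ-syntax; ∃-syntax; _×_; _,_; proj₁; proj₂; uncurry)
open import Data.Rational.Base as ℚ using (ℚ; 0ℚ; 1ℚ; ½; ∣_∣)
import Data.Rational.Properties as ℚₚ
open import Data.Rational.Solver using (module +-*-Solver)
import Data.Rational.Unnormalised.Base as ℚᵘ
open import Data.Sum.Base using (inj₁; inj₂; [_,_]′)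
open import Data.Vec.Functional using (Vector)
open import Function.Base using (_∘_; id)
open import Level using (0ℓ)
open import Relation.Binary.Core using (Rel)
open import Relation.Binary.Definitions using (tri<; tri≈; tri>)
open import Relation.Binary.PropositionalEquality as ≡ using (_≡_; _≢_)
open import Relation.Nullary using (¬_; yes; no; contradiction)
open import Relation.Nullary.Decidable.Core using (dec⇒maybe)
open import Relation.Unary using (_≐_; _∈_)

-- Gram forms over a commutative ring

-- The squared norm is 2 (Q + t X + s Y), where Q = Σ zᵢ² and X, Y do not involve α. Here 0 ≤ s ≤ t
-- < 1, so the pair (t, s) lies in the triangle with corners (0, 0), (1, 0) and (1, 1), where the
-- form in parentheses is Q, Q + X = A and Q + X + Y = D. The three weights are the barycentric
-- coordinates of (t, s), doubled. The corners (0, 0) and (1, 1) are α = √2 and α = 1; the latter is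
-- excluded because the weight of Q vanishes there. The obstacle is that the order on the Cauchy
-- reals cannot be decided, so neither the minimum nor the equality case can be found by comparing
-- real numbers. Every case distinction on vectors is therefore made on the integer coefficients,
-- and the real order enters through axioms without totality. The forms are defined over any
-- commutative ring with a map from ℤ: over ℤ they yield the bounds by 1, over ℝ the norm, and the
-- map carries the bounds across.

ℤ-Morphism : CommutativeRing 0ℓ 0ℓ → Set
ℤ-Morphism R = ℤ.+-*-rawRing -Raw-AlmostCommutative⟶ fromCommutativeRing R

module GramForm (R : CommutativeRing 0ℓ 0ℓ) (ℤ⟶R : ℤ-Morphism R) where

  open CommutativeRing R hiding (zero)
  open import Algebra.Properties.Semiring.Sum semiring public
    using (sum; sum-cong-≋)
  open import Relation.Binary.Reasoning.Setoid setoid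
  open _-Raw-AlmostCommutative⟶_ ℤ⟶R public renaming (⟦_⟧ to ι)

  -- Coefficients are compared in ℤ, where equality is decidable; in R it need not be.
  open Algebra.Solver.Ring ℤ.+-*-rawRing (fromCommutativeRing R) ℤ⟶R
    (λ i j → Maybe.map (reflexive ∘ ≡.cong ι) (dec⇒maybe (i ℤₚ.≟ j))) public
    using (solve; _:=_; _:+_; _:*_; _:-_; :-_; con)

  2# : Carrier
  2# = ι (+ 2)

  sumOfSquares : ∀ {n} → Vector Carrier n → Carrier
  sumOfSquares x = sum (λ i → x i * x i)

  sumOfSquares-cong : ∀ {n} {x y : Vector Carrier n} → (∀ i → x i ≈ y i) →
                      sumOfSquares x ≈ sumOfSquares y
  sumOfSquares-cong x≈y = sum-cong-≋ (λ i → *-cong (x≈y i) (x≈y i))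

  -- The default zero past the end covers the last row of `steps` and, for n = 3, the empty tail.
  extend : ∀ {m} → Vector Carrier m → ℕ → Carrier
  extend {zero}  d k       = 0#
  extend {suc m} d zero    = d zero
  extend {suc m} d (suc k) = extend (d ∘ suc) k

  extend-toℕ : ∀ {m} (d : Vector Carrier m) k → extend d (toℕ k) ≈ d k
  extend-toℕ d zero    = refl
  extend-toℕ d (suc k) = extend-toℕ (d ∘ suc) k

  tail₃ : ∀ {m} → Vector Carrier (3 ℕ.+ m) → Vector Carrier m
  tail₃ z i = z (suc (suc (suc i)))

  adjacent : ∀ {m} → Vector Carrier m → Carrier
  adjacent {zero}  d = 0#
  adjacent {suc m} d = d zero * extend d 1 + adjacent (d ∘ suc)

  steps : ∀ {m} → Carrier → Carrier → Vector Carrier m → Vector Carrier m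
  steps a c d k = c * extend d (suc (toℕ k)) - a * d k

  -- The coordinates of Σ zᵢ bᵢ, for α = a and ᾱ = c.
  image : ∀ {m} → Carrier → Carrier → Vector Carrier (3 ℕ.+ m) → Vector Carrier (3 ℕ.+ m)
  image a c z zero                = a * z zero + c * z (suc (suc zero))
  image a c z (suc zero)          = c * z zero + a * z (suc zero)
  image a c z (suc (suc zero))    = c * z (suc zero) + a * z (suc (suc zero))
                                      + c * extend (tail₃ z) 0
  image a c z (suc (suc (suc k))) = steps a c (tail₃ z) k

  -- Distinct basis vectors have inner product 0 or ± αᾱ, except that b₂ and b₄ have ᾱ². `cross`
  -- collects the pairs of the first kind with their signs, `skew` is the exceptional pair.
  cross skew : ∀ {m} → Vector Carrier (3 ℕ.+ m) → Carrier
  cross z = z zero * z (suc zero) + z zero * z (suc (suc zero))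
    + z (suc zero) * z (suc (suc zero))
    + z (suc (suc zero)) * extend (tail₃ z) 0 - adjacent (tail₃ z)
  skew z = z (suc zero) * extend (tail₃ z) 0

  formA formD : ∀ {m} → Vector Carrier (3 ℕ.+ m) → Carrier
  formA z = sumOfSquares z + cross z
  formD z = formA z + skew z

  -- After a sign change in the third entry the entries sum to zero: this is the root lattice Aₙ in
  -- its usual hyperplane of n + 1 coordinates.
  squaresA : ∀ {m} → Vector Carrier (3 ℕ.+ m) → Vector Carrier (4 ℕ.+ m)
  squaresA z zero                      = z zero
  squaresA z (suc zero)                = z (suc zero)
  squaresA z (suc (suc zero))          = z zero + z (suc zero) + z (suc (suc zero))
  squaresA z (suc (suc (suc zero)))    = z (suc (suc zero)) + extend (tail₃ z) 0
  squaresA z (suc (suc (suc (suc k)))) = steps (ι (+ 1)) (ι (+ 1)) (tail₃ z) k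

  -- For α = ᾱ = 1 the bᵢ form a basis of the root lattice Dₙ.
  squaresD : ∀ {m} → Vector Carrier (3 ℕ.+ m) → Vector Carrier (3 ℕ.+ m)
  squaresD = image (ι (+ 1)) (ι (+ 1))

  -- The shifted squares c² dₖ₊₁² miss only the first entry, hence the correction by (c d₀)². In
  -- `gram` it cancels against the square from the third coordinate.
  sumOfSquares-steps : ∀ {m} a c (d : Vector Carrier m) →
    sumOfSquares (steps a c d) ≈
      (a * a + c * c) * sumOfSquares d - 2# * (a * c) * adjacent d
        - (c * extend d 0) * (c * extend d 0)
  -- The solver's constant is `ι (+ 0)`, so the `0#` of the empty sums is exchanged for it and back.
  sumOfSquares-steps {zero} a c d = begin
    0#          ≈⟨ 0-homo ⟨
    ι (+ 0)     ≈⟨ solve 2 (λ a c → con (+ 0) := (a :* a :+ c :* c) :* con (+ 0)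
                     :- con (+ 2) :* (a :* c) :* con (+ 0)
                     :- (c :* con (+ 0)) :* (c :* con (+ 0))) refl a c ⟩
    P (ι (+ 0)) ≈⟨ +-cong (+-cong (*-congˡ 0-homo) (-‿cong (*-congˡ 0-homo)))
                     (-‿cong (*-cong (*-congˡ 0-homo) (*-congˡ 0-homo))) ⟩
    P 0#        ∎
    where
    P : Carrier → Carrier
    P x = (a * a + c * c) * x - 2# * (a * c) * x - (c * x) * (c * x)
  sumOfSquares-steps {suc m} a c d =
    trans (+-congˡ (sumOfSquares-steps a c (d ∘ suc)))
      (solve 6 (λ a c x y s p →
        (c :* y :- a :* x) :* (c :* y :- a :* x)
          :+ ((a :* a :+ c :* c) :* s :- con (+ 2) :* (a :* c) :* p :- (c :* y) :* (c :* y))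
        := (a :* a :+ c :* c) :* (x :* x :+ s) :- con (+ 2) :* (a :* c) :* (x :* y :+ p)
          :- (c :* x) :* (c :* x))
        refl a c (d zero) (extend (d ∘ suc) 0)
          (sumOfSquares (d ∘ suc)) (adjacent (d ∘ suc)))

  gram : ∀ {m} a c (z : Vector Carrier (3 ℕ.+ m)) →
    sumOfSquares (image a c z) ≈
      (a * a + c * c) * sumOfSquares z + 2# * (a * c) * cross z + 2# * (c * c) * skew z
  gram a c z =
    trans (+-congˡ (+-congˡ (+-congˡ (sumOfSquares-steps a c (tail₃ z)))))
      (solve 8 (λ a c x y z e s p →
        (a :* x :+ c :* z) :* (a :* x :+ c :* z)
          :+ ((c :* x :+ a :* y) :* (c :* x :+ a :* y)
          :+ ((c :* y :+ a :* z :+ c :* e) :* (c :* y :+ a :* z :+ c :* e)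
          :+ ((a :* a :+ c :* c) :* s :- con (+ 2) :* (a :* c) :* p :- (c :* e) :* (c :* e))))
        := (a :* a :+ c :* c) :* (x :* x :+ (y :* y :+ (z :* z :+ s)))
          :+ con (+ 2) :* (a :* c) :* (x :* y :+ x :* z :+ y :* z :+ z :* e :- p)
          :+ con (+ 2) :* (c :* c) :* (y :* e))
        refl a c (z zero) (z (suc zero)) (z (suc (suc zero))) (extend (tail₃ z) 0)
          (sumOfSquares (tail₃ z)) (adjacent (tail₃ z)))

  sumOfSquares-squaresA : ∀ {m} (z : Vector Carrier (3 ℕ.+ m)) →
    sumOfSquares (squaresA z) ≈ 2# * formA z
  sumOfSquares-squaresA z =
    trans (+-congˡ (+-congˡ (+-congˡ (+-congˡ
        (sumOfSquares-steps (ι (+ 1)) (ι (+ 1)) (tail₃ z))))))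
      (solve 6 (λ x y z e s p →
        x :* x :+ (y :* y :+ ((x :+ y :+ z) :* (x :+ y :+ z) :+ ((z :+ e) :* (z :+ e)
          :+ ((con (+ 1) :* con (+ 1) :+ con (+ 1) :* con (+ 1)) :* s
            :- con (+ 2) :* (con (+ 1) :* con (+ 1)) :* p
            :- (con (+ 1) :* e) :* (con (+ 1) :* e)))))
        := con (+ 2) :* (x :* x :+ (y :* y :+ (z :* z :+ s))
          :+ (x :* y :+ x :* z :+ y :* z :+ z :* e :- p)))
        refl (z zero) (z (suc zero)) (z (suc (suc zero))) (extend (tail₃ z) 0)
          (sumOfSquares (tail₃ z)) (adjacent (tail₃ z)))

  sumOfSquares-squaresD : ∀ {m} (z : Vector Carrier (3 ℕ.+ m)) →
    sumOfSquares (squaresD z) ≈ 2# * formD z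
  sumOfSquares-squaresD z = trans (gram (ι (+ 1)) (ι (+ 1)) z)
    (solve 3 (λ s g h →
      (con (+ 1) :* con (+ 1) :+ con (+ 1) :* con (+ 1)) :* s
        :+ con (+ 2) :* (con (+ 1) :* con (+ 1)) :* g
        :+ con (+ 2) :* (con (+ 1) :* con (+ 1)) :* h
      := con (+ 2) :* (s :+ g :+ h))
      refl (sumOfSquares z) (cross z) (skew z))

  -- Abel summation: the coefficients 1, ac, c² are replaced by their successive differences, and
  -- the three terms by their partial sums.
  gram-convex : ∀ {m} a c (z : Vector Carrier (3 ℕ.+ m)) → a * a + c * c ≈ 2# →
    sumOfSquares (image a c z) ≈
      2# * (ι (+ 1) - a * c) * sumOfSquares z + 2# * (a * c - c * c) * formA z
        + 2# * (c * c) * formD z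
  gram-convex a c z eq =
    trans (gram a c z) (trans (+-congʳ (+-congʳ (*-congʳ eq)))
      (solve 5 (λ a c s g h →
        con (+ 2) :* s :+ con (+ 2) :* (a :* c) :* g :+ con (+ 2) :* (c :* c) :* h
        := con (+ 2) :* (con (+ 1) :- a :* c) :* s
          :+ con (+ 2) :* (a :* c :- c :* c) :* (s :+ g)
          :+ con (+ 2) :* (c :* c) :* (s :+ g :+ h))
        refl a c (sumOfSquares z) (cross z) (skew z)))

  -- Coordinates of linear combinations of the basis

  kronecker : ℕ → ℕ → Carrier
  kronecker k j = if k ℕ.≡ᵇ j then ι (+ 1) else ι (+ 0)

  sum-zero : ∀ {n} {x : Vector Carrier n} → (∀ i → x i ≈ 0#) → sum x ≈ 0#
  sum-zero {zero}  x≈0 = refl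
  sum-zero {suc n} x≈0 = trans (+-cong (x≈0 zero) (sum-zero (x≈0 ∘ suc))) (+-identityˡ 0#)

  *-ι0 : ∀ x → x * ι (+ 0) ≈ 0#
  *-ι0 x = trans (*-congˡ 0-homo) (zeroʳ x)

  sum-kronecker : ∀ {m} (d : Vector Carrier m) j →
    sum (λ i → d i * kronecker (toℕ i) j) ≈ extend d j
  sum-kronecker {zero}  d j       = refl
  sum-kronecker {suc m} d zero    = trans
    (+-cong (trans (*-congˡ 1-homo) (*-identityʳ (d zero)))
      (sum-zero (λ i → *-ι0 (d (suc i)))))
    (+-identityʳ (d zero))
  sum-kronecker {suc m} d (suc j) = trans
    (+-cong (*-ι0 (d zero)) (sum-kronecker (d ∘ suc) j))
    (+-identityˡ (extend (d ∘ suc) j))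

  sum-*-ι0 : ∀ {n} (d : Vector Carrier n) → sum (λ i → d i * ι (+ 0)) ≈ ι (+ 0)
  sum-*-ι0 d = trans (sum-zero (λ i → *-ι0 (d i))) (sym 0-homo)

  sum-bidiagonal : ∀ {n} a c (d p q : Vector Carrier n) →
    sum (λ i → d i * (c * p i - a * q i)) ≈
      c * sum (λ i → d i * p i) - a * sum (λ i → d i * q i)
  sum-bidiagonal {zero} a c d p q = sym (trans
    (+-cong (zeroʳ c) (-‿cong (zeroʳ a))) (-‿inverseʳ 0#))
  sum-bidiagonal {suc n} a c d p q =
    trans (+-congˡ (sum-bidiagonal a c (d ∘ suc) (p ∘ suc) (q ∘ suc)))
      (solve 7 (λ a c d p q u v →
        d :* (c :* p :- a :* q) :+ (c :* u :- a :* v)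
        := c :* (d :* p :+ u) :- a :* (d :* q :+ v))
        refl a c (d zero) (p zero) (q zero)
        (sum (λ i → d (suc i) * p (suc i))) (sum (λ i → d (suc i) * q (suc i))))

  -- Over ℝ, the left-hand side unfolds to linearCombination z (basis (3 + m) a) j
  -- with c in place of ᾱ; kronecker takes the values ι 1 and ι 0 for that reason.
  combination≈image : ∀ {m} a c (z : Vector Carrier (3 ℕ.+ m)) (j : Fin (3 ℕ.+ m)) →
    let δ : ℕ → Carrier
        δ k = kronecker k (toℕ j)
    in z zero * (a * δ 0 + c * δ 1)
       + (z (suc zero) * (a * δ 1 + c * δ 2)
       + (z (suc (suc zero)) * (c * δ 0 + a * δ 2)
       + sum (λ i → tail₃ z i * (c * δ (2 ℕ.+ toℕ i) - a * δ (3 ℕ.+ toℕ i)))))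
       ≈ image a c z j
  combination≈image a c z j = trans (+-congˡ (+-congˡ (+-congˡ
      (sum-bidiagonal a c (tail₃ z) (λ i → kronecker (2 ℕ.+ toℕ i) (toℕ j))
        (λ i → kronecker (3 ℕ.+ toℕ i) (toℕ j)))))) (coordinate j)
    where
    d = tail₃ z
    tail-cong : ∀ {t u v w x} → u ≈ v → w ≈ x → t + (c * u - a * w) ≈ t + (c * v - a * x)
    tail-cong u≈v w≈x = +-congˡ (+-cong (*-congˡ u≈v) (-‿cong (*-congˡ w≈x)))
    coordinate : ∀ j →
      let δ : ℕ → Carrier
          δ k = kronecker k (toℕ j)
      in z zero * (a * δ 0 + c * δ 1)
         + (z (suc zero) * (a * δ 1 + c * δ 2)
         + (z (suc (suc zero)) * (c * δ 0 + a * δ 2)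
         + (c * sum (λ i → d i * δ (2 ℕ.+ toℕ i)) - a * sum (λ i → d i * δ (3 ℕ.+ toℕ i)))))
         ≈ image a c z j
    coordinate zero = trans
      (+-congˡ (+-congˡ (tail-cong (sum-*-ι0 d) (sum-*-ι0 d))))
      (solve 5 (λ a c x y z →
        x :* (a :* con (+ 1) :+ c :* con (+ 0))
          :+ (y :* (a :* con (+ 0) :+ c :* con (+ 0))
          :+ (z :* (c :* con (+ 1) :+ a :* con (+ 0))
          :+ (c :* con (+ 0) :- a :* con (+ 0))))
        := a :* x :+ c :* z) refl a c (z zero) (z (suc zero)) (z (suc (suc zero))))
    coordinate (suc zero) = trans
      (+-congˡ (+-congˡ (tail-cong (sum-*-ι0 d) (sum-*-ι0 d))))
      (solve 5 (λ a c x y z →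
        x :* (a :* con (+ 0) :+ c :* con (+ 1))
          :+ (y :* (a :* con (+ 1) :+ c :* con (+ 0))
          :+ (z :* (c :* con (+ 0) :+ a :* con (+ 0))
          :+ (c :* con (+ 0) :- a :* con (+ 0))))
        := c :* x :+ a :* y) refl a c (z zero) (z (suc zero)) (z (suc (suc zero))))
    coordinate (suc (suc zero)) = trans
      (+-congˡ (+-congˡ (tail-cong (sum-kronecker d 0) (sum-*-ι0 d))))
      (solve 6 (λ a c x y z e →
        x :* (a :* con (+ 0) :+ c :* con (+ 0))
          :+ (y :* (a :* con (+ 0) :+ c :* con (+ 1))
          :+ (z :* (c :* con (+ 0) :+ a :* con (+ 1))
          :+ (c :* e :- a :* con (+ 0))))
        := c :* y :+ a :* z :+ c :* e) refl a c (z zero) (z (suc zero)) (z (suc (suc zero)))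
          (extend d 0))
    coordinate (suc (suc (suc k))) = trans
      (+-congˡ (+-congˡ (tail-cong (sum-kronecker d (suc (toℕ k)))
        (trans (sum-kronecker d (toℕ k)) (extend-toℕ d k)))))
      (solve 7 (λ a c x y z u v →
        x :* (a :* con (+ 0) :+ c :* con (+ 0))
          :+ (y :* (a :* con (+ 0) :+ c :* con (+ 0))
          :+ (z :* (c :* con (+ 0) :+ a :* con (+ 0))
          :+ (c :* u :- a :* v)))
        := c :* u :- a :* v) refl a c (z zero) (z (suc zero)) (z (suc (suc zero)))
          (extend d (suc (toℕ k))) (d k))

-- Integral coefficient vectors

module IntegralForms where

  open import Data.Integer.Base using (_+_; _*_; _-_; -_; _≤_; _<_)
  open ≡ using (refl; sym; trans; cong; cong₂; subst)

  ℤ⟶ℤ : ℤ-Morphism ℤₚ.+-*-commutativeRing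
  ℤ⟶ℤ = -raw-almostCommutative⟶ (fromCommutativeRing ℤₚ.+-*-commutativeRing)

  open GramForm ℤₚ.+-*-commutativeRing ℤ⟶ℤ public

  square≥0 : ∀ i → + 0 ≤ i * i
  square≥0 (+ n)    = subst (+ 0 ≤_) (ℤₚ.pos-* n n) (ℤ.+≤+ ℕ.z≤n)
  square≥0 -[1+ n ] = ℤ.+≤+ ℕ.z≤n

  sumOfSquares≥0 : ∀ {n} (x : Vector ℤ n) → + 0 ≤ sumOfSquares x
  sumOfSquares≥0 {zero}  x = ℤₚ.≤-refl
  sumOfSquares≥0 {suc n} x = ℤₚ.+-mono-≤ (square≥0 (x zero)) (sumOfSquares≥0 (x ∘ suc))

  +-nonneg-≡0 : ∀ {i j} → + 0 ≤ i → + 0 ≤ j → i + j ≡ + 0 → i ≡ + 0 × j ≡ + 0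
  +-nonneg-≡0 {+ zero}  {+ zero}  _ _ _ = refl , refl
  +-nonneg-≡0 {+ zero}  {+ suc _} _ _ ()
  +-nonneg-≡0 {+ suc _} {+ _}     _ _ ()

  sumOfSquares≡0 : ∀ {n} (x : Vector ℤ n) → sumOfSquares x ≡ + 0 → ∀ i → x i ≡ + 0
  sumOfSquares≡0 {suc n} x eq = λ where
      zero    → [ id , id ]′ (ℤₚ.i*j≡0⇒i≡0∨j≡0 (x zero) (proj₁ both))
      (suc i) → sumOfSquares≡0 (x ∘ suc) (proj₂ both) i
    where both = +-nonneg-≡0 (square≥0 (x zero)) (sumOfSquares≥0 (x ∘ suc)) eq

  -- Back substitution: the last step is minus the last entry, and each earlier step ties an entry
  -- to its successor.
  steps≡0 : ∀ {m} (d : Vector ℤ m) → (∀ k → steps (+ 1) (+ 1) d k ≡ + 0) →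
            ∀ k → d k ≡ + 0
  steps≡0 {suc m} d eq = λ where
      zero    → trans (sym (ℤₚ.*-identityˡ (d zero)))
        (trans (sym (ℤₚ.i-j≡0⇒i≡j (+ 1 * extend d 1) (+ 1 * d zero) (eq zero)))
          (trans (ℤₚ.*-identityˡ (extend d 1)) (extend≡0 (d ∘ suc) rest 0)))
      (suc k) → rest k
    where
    rest = steps≡0 (d ∘ suc) (eq ∘ suc)
    extend≡0 : ∀ {m} (d : Vector ℤ m) → (∀ k → d k ≡ + 0) → ∀ k → extend d k ≡ + 0
    extend≡0 {zero}  d d≡0 k       = refl
    extend≡0 {suc m} d d≡0 zero    = d≡0 zero
    extend≡0 {suc m} d d≡0 (suc k) = extend≡0 (d ∘ suc) (d≡0 ∘ suc) k

  squaresA≡0 : ∀ {m} (z : Vector ℤ (3 ℕ.+ m)) → (∀ k → squaresA z k ≡ + 0) → ∀ k → z k ≡ + 0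
  squaresA≡0 z eq zero             = eq zero
  squaresA≡0 z eq (suc zero)       = eq (suc zero)
  squaresA≡0 z eq (suc (suc zero)) = trans
    (sym (trans (cong₂ (λ x y → x + y + z (suc (suc zero))) (eq zero) (eq (suc zero)))
      (ℤₚ.+-identityˡ (z (suc (suc zero))))))
    (eq (suc (suc zero)))
  squaresA≡0 z eq (suc (suc (suc k))) =
    steps≡0 (tail₃ z) (λ k → eq (suc (suc (suc (suc k))))) k

  -- Once the tail vanishes, the first three entries are the pairwise sums of x₀, x₁, x₂. Signed
  -- combinations of these sums give twice each coordinate, and 2 cancels in ℤ.
  squaresD≡0 : ∀ {m} (z : Vector ℤ (3 ℕ.+ m)) → (∀ k → squaresD z k ≡ + 0) → ∀ k → z k ≡ + 0
  squaresD≡0 {m} z eq = λ where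
      zero                → half (trans
        (solve 3 (λ x y z → con (+ 2) :* x :=
          (con (+ 1) :* x :+ con (+ 1) :* z) :+ (con (+ 1) :* x :+ con (+ 1) :* y)
            :- (y :+ z)) refl x₀ x₁ x₂)
        (cong₂ _-_ (cong₂ _+_ (eq zero) (eq (suc zero))) y+z≡0))
      (suc zero)          → half (trans
        (solve 3 (λ x y z → con (+ 2) :* y :=
          (con (+ 1) :* x :+ con (+ 1) :* y) :+ (y :+ z)
            :- (con (+ 1) :* x :+ con (+ 1) :* z)) refl x₀ x₁ x₂)
        (cong₂ _-_ (cong₂ _+_ (eq (suc zero)) y+z≡0) (eq zero)))
      (suc (suc zero))    → half (trans
        (solve 3 (λ x y z → con (+ 2) :* z :=
          (y :+ z) :+ (con (+ 1) :* x :+ con (+ 1) :* z)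
            :- (con (+ 1) :* x :+ con (+ 1) :* y)) refl x₀ x₁ x₂)
        (cong₂ _-_ (cong₂ _+_ y+z≡0 (eq zero)) (eq (suc zero))))
      (suc (suc (suc k))) → d≡0 k
    where
    x₀ = z zero
    x₁ = z (suc zero)
    x₂ = z (suc (suc zero))
    d≡0 : ∀ k → tail₃ z k ≡ + 0
    d≡0 = steps≡0 (tail₃ z) (λ k → eq (suc (suc (suc k))))
    half : ∀ {i} → + 2 * i ≡ + 0 → i ≡ + 0
    half {i} = ℤₚ.*-cancelˡ-≡ (+ 2) i (+ 0)
    e≡0 : ∀ {m} (d : Vector ℤ m) → (∀ k → d k ≡ + 0) → extend d 0 ≡ + 0
    e≡0 {zero}  d _   = refl
    e≡0 {suc m} d d≡0 = d≡0 zero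
    y+z≡0 : x₁ + x₂ ≡ + 0
    y+z≡0 = trans
      (sym (trans (cong (λ e → + 1 * x₁ + + 1 * x₂ + + 1 * e) (e≡0 (tail₃ z) d≡0))
        (solve 2 (λ y z → con (+ 1) :* y :+ con (+ 1) :* z :+ con (+ 1) :* con (+ 0)
          := y :+ z) refl x₁ x₂)))
      (eq (suc (suc zero)))

  -- Integrality enters here: the squares only show that 2i is positive, and a positive integer is
  -- at least 1.
  half≥1 : ∀ {i s} → s ≡ + 2 * i → + 0 ≤ s → s ≢ + 0 → + 1 ≤ i
  half≥1 {i} {s} s≡2i 0≤s s≢0 = ℤₚ.i<j⇒suc[i]≤j (ℤₚ.*-cancelˡ-<-nonNeg {+ 0} {i} (+ 2)
    (subst (+ 0 <_) s≡2i (ℤₚ.≤∧≢⇒< 0≤s (s≢0 ∘ sym))))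

  sumOfSquares≥1 : ∀ {n} (z : Vector ℤ n) → ¬ (∀ k → z k ≡ + 0) → + 1 ≤ sumOfSquares z
  sumOfSquares≥1 z z≢0 = ℤₚ.i<j⇒suc[i]≤j
    (ℤₚ.≤∧≢⇒< (sumOfSquares≥0 z) (z≢0 ∘ sumOfSquares≡0 z ∘ sym))

  module _ {m} (z : Vector ℤ (3 ℕ.+ m)) (z≢0 : ¬ (∀ k → z k ≡ + 0)) where

    formA≥1 : + 1 ≤ formA z
    formA≥1 = half≥1 (sumOfSquares-squaresA z) (sumOfSquares≥0 (squaresA z))
      (λ eq → z≢0 (squaresA≡0 z (sumOfSquares≡0 (squaresA z) eq)))

    formD≥1 : + 1 ≤ formD z
    formD≥1 = half≥1 (sumOfSquares-squaresD z) (sumOfSquares≥0 (squaresD z))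
      (λ eq → z≢0 (squaresD≡0 z (sumOfSquares≡0 (squaresD z) eq)))

  -- Signed unit vectors and the integral equality case

  sign : Fin 2 → ℤ
  sign zero       = + 1
  sign (suc zero) = -[1+ 0 ]

  sign-square : ∀ σ → sign σ * sign σ ≡ + 1
  sign-square zero       = refl
  sign-square (suc zero) = refl

  single : ∀ {n} → Fin n → ℤ → Vector ℤ n
  single zero    s zero    = s
  single zero    s (suc k) = + 0
  single (suc i) s zero    = + 0
  single (suc i) s (suc k) = single i s k

  single-*-≡0 : ∀ {n} (i : Fin n) s {j k} → j ≢ k → single i s j * single i s k ≡ + 0
  single-*-≡0 zero    s {zero}  {zero}  j≢k = contradiction refl j≢k
  single-*-≡0 zero    s {zero}  {suc k} j≢k = ℤₚ.*-zeroʳ s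
  single-*-≡0 zero    s {suc j} {k}     j≢k = refl
  single-*-≡0 (suc i) s {zero}  {k}     j≢k = refl
  single-*-≡0 (suc i) s {suc j} {zero}  j≢k = ℤₚ.*-zeroʳ (single i s j)
  single-*-≡0 (suc i) s {suc j} {suc k} j≢k = single-*-≡0 i s (j≢k ∘ cong suc)

  sumOfSquares-single : ∀ {n} (i : Fin n) s → sumOfSquares (single i s) ≡ s * s
  sumOfSquares-single {suc n} zero s = trans
    (cong (λ t → s * s + t) (sum-zero {n} {λ _ → + 0} λ _ → refl)) (ℤₚ.+-identityʳ (s * s))
  sumOfSquares-single (suc i) s    = trans (ℤₚ.+-identityˡ _) (sumOfSquares-single i s)

  -- `cross` and `skew` contain only products of distinct coordinates, so this condition makes both
  -- vanish wherever the nonzero entry of a unit vector sits.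
  Orthogonal : ∀ {n} → Vector ℤ n → Set
  Orthogonal z = ∀ {j k} → j ≢ k → z j * z k ≡ + 0

  orthogonal⇒adjacent≡0 : ∀ {m} (d : Vector ℤ m) → Orthogonal d → adjacent d ≡ + 0
  orthogonal⇒adjacent≡0 {zero}        d orth = refl
  orthogonal⇒adjacent≡0 {suc zero}    d orth = cong (λ t → t + + 0) (ℤₚ.*-zeroʳ (d zero))
  orthogonal⇒adjacent≡0 {suc (suc m)} d orth = cong₂ _+_ (orth λ ())
    (orthogonal⇒adjacent≡0 (d ∘ suc) (λ j≢k → orth (j≢k ∘ Finₚ.suc-injective)))

  orthogonal⇒*-extend≡0 : ∀ {m} (z : Vector ℤ (3 ℕ.+ m)) → Orthogonal z → ∀ {j} →
    (∀ {k} → j ≢ suc (suc (suc k))) → z j * extend (tail₃ z) 0 ≡ + 0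
  orthogonal⇒*-extend≡0 {zero}  z orth {j} j≢ = ℤₚ.*-zeroʳ (z j)
  orthogonal⇒*-extend≡0 {suc m} z orth     j≢ = orth j≢

  orthogonal⇒skew≡0 : ∀ {m} (z : Vector ℤ (3 ℕ.+ m)) → Orthogonal z → skew z ≡ + 0
  orthogonal⇒skew≡0 z orth = orthogonal⇒*-extend≡0 z orth λ ()

  orthogonal⇒cross≡0 : ∀ {m} (z : Vector ℤ (3 ℕ.+ m)) → Orthogonal z → cross z ≡ + 0
  orthogonal⇒cross≡0 z orth = cong₂ _-_
    (cong₂ _+_ (cong₂ _+_ (cong₂ _+_ (orth λ ()) (orth λ ())) (orth λ ()))
      (orthogonal⇒*-extend≡0 z orth λ ()))
    (orthogonal⇒adjacent≡0 (tail₃ z)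
      (λ j≢k → orth (j≢k ∘ Finₚ.suc-injective ∘ Finₚ.suc-injective ∘ Finₚ.suc-injective)))

  unit : ∀ {n} → Fin 2 → Fin n → Vector ℤ n
  unit σ i = single i (sign σ)

  sumOfSquares-unit : ∀ {n} σ (i : Fin n) → sumOfSquares (unit σ i) ≡ + 1
  sumOfSquares-unit σ i = trans (sumOfSquares-single i (sign σ)) (sign-square σ)

  formA-unit : ∀ {m} σ (i : Fin (3 ℕ.+ m)) → formA (unit σ i) ≡ + 1
  formA-unit σ i = cong₂ _+_ (sumOfSquares-unit σ i)
    (orthogonal⇒cross≡0 (unit σ i) (single-*-≡0 i (sign σ)))

  formD-unit : ∀ {m} σ (i : Fin (3 ℕ.+ m)) → formD (unit σ i) ≡ + 1
  formD-unit σ i = cong₂ _+_ (formA-unit σ i)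
    (orthogonal⇒skew≡0 (unit σ i) (single-*-≡0 i (sign σ)))

  unit-injective : ∀ {n} {σ τ} {i j : Fin n} → (∀ k → unit σ i k ≡ unit τ j k) →
                   (σ , i) ≡ (τ , j)
  unit-injective {i = zero}  {j = zero}  eq = cong (_, zero) (sign-injective (eq zero))
    where
    sign-injective : ∀ {σ τ} → sign σ ≡ sign τ → σ ≡ τ
    sign-injective {zero}     {zero}     _ = refl
    sign-injective {zero}     {suc zero} ()
    sign-injective {suc zero} {zero}     ()
    sign-injective {suc zero} {suc zero} _ = refl
  unit-injective {σ = σ} {i = zero}  {j = suc j} eq = contradiction (eq zero) (sign≢0 σ)
    where
    sign≢0 : ∀ σ → sign σ ≢ + 0
    sign≢0 zero       ()
    sign≢0 (suc zero) ()
  unit-injective {τ = zero}     {i = suc i} {j = zero} eq with () ← eq zero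
  unit-injective {τ = suc zero} {i = suc i} {j = zero} eq with () ← eq zero
  unit-injective {i = suc i} {j = suc j} eq =
    cong (λ (σ , i) → σ , suc i) (unit-injective (eq ∘ suc))

  -- The gap behind the equality case: beyond zero and the signed unit vectors, the sum of squares
  -- jumps to at least 2.
  data Size {n} (z : Vector ℤ n) : Set where
    isZero : (∀ k → z k ≡ + 0) → Size z
    isUnit : ∀ σ i → (∀ k → z k ≡ unit σ i k) → Size z
    isBig  : + 2 ≤ sumOfSquares z → Size z

  size : ∀ {n} (z : Vector ℤ n) → Size z
  size {zero}  z = isZero λ ()
  size {suc n} z with z zero in eq | size (z ∘ suc)
  ... | +0 | isZero z≡0   = isZero λ { zero → eq ; (suc k) → z≡0 k }
  ... | +0 | isUnit σ i h = isUnit σ (suc i) λ { zero → eq ; (suc k) → h k }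
  ... | z₀ | isBig h = isBig (ℤₚ.+-mono-≤ (square≥0 (z zero)) h)
  ... | +[1+ 0 ] | isZero z≡0 = isUnit zero zero λ { zero → eq ; (suc k) → z≡0 k }
  ... | -[1+ 0 ] | isZero z≡0 = isUnit (suc zero) zero λ { zero → eq ; (suc k) → z≡0 k }
  ... | +[1+ 0 ] | isUnit σ i h = isBig (ℤₚ.≤-reflexive (sym (cong₂ _+_ (cong (λ x → x * x) eq)
        (trans (sumOfSquares-cong h) (sumOfSquares-unit σ i)))))
  ... | -[1+ 0 ] | isUnit σ i h = isBig (ℤₚ.≤-reflexive (sym (cong₂ _+_ (cong (λ x → x * x) eq)
        (trans (sumOfSquares-cong h) (sumOfSquares-unit σ i)))))
  ... | +[1+ suc n ] | _ = isBig (ℤₚ.+-mono-≤ (subst (λ x → + 2 ≤ x * x) (sym eq)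
        (ℤ.+≤+ (ℕ.s≤s (ℕ.s≤s ℕ.z≤n)))) (sumOfSquares≥0 (z ∘ suc)))
  ... | -[1+ suc n ] | _ = isBig (ℤₚ.+-mono-≤ (subst (λ x → + 2 ≤ x * x) (sym eq)
        (ℤ.+≤+ (ℕ.s≤s (ℕ.s≤s ℕ.z≤n)))) (sumOfSquares≥0 (z ∘ suc)))

-- Ordered fields with square roots

record EuclideanField : Set₁ where
  infix 4 _≤_ _<_
  field
    commutativeRing : CommutativeRing 0ℓ 0ℓ
    ℤ⟶R             : ℤ-Morphism commutativeRing

  open CommutativeRing commutativeRing
  open _-Raw-AlmostCommutative⟶_ ℤ⟶R using () renaming (⟦_⟧ to ι)

  field
    _≤_ _<_         : Rel Carrier 0ℓ
    √               : Carrier → Carrier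
    ≤-reflexive     : ∀ {x y} → x ≈ y → x ≤ y
    ≤-trans         : ∀ {x y z} → x ≤ y → y ≤ z → x ≤ z
    ≤-antisym       : ∀ {x y} → x ≤ y → y ≤ x → x ≈ y
    +-mono-≤        : ∀ {x y u v} → x ≤ y → u ≤ v → x + u ≤ y + v
    square-nonneg   : ∀ x → 0# ≤ x * x
    -- This stands in for arguments by totality; `square≈0`, `c≤a` and the monotonicity of √ rest on
    -- it.
    square-cancel-≤ : ∀ {x y} → 0# ≤ y → x * x ≤ y * y → x ≤ y
    <-irrefl        : ∀ {x} → ¬ x < x
    <⇒≤             : ∀ {x y} → x < y → x ≤ y
    <-≤-trans       : ∀ {x y z} → x < y → y ≤ z → x < z
    ≤-<-trans       : ∀ {x y z} → x ≤ y → y < z → x < z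
    +-monoˡ-<       : ∀ {x y} z → x < y → x + z < y + z
    *-pos           : ∀ {x y} → 0# < x → 0# < y → 0# < x * y
    inverse         : ∀ {x} → 0# < x → ∃[ y ] x * y ≈ 1#
    √-nonneg        : ∀ x → 0# ≤ √ x
    √-square        : ∀ {x} → 0# ≤ x → √ x * √ x ≈ x
    ι-mono-≤        : ∀ {i j} → i ℤ.≤ j → ι i ≤ ι j
    ι-mono-<        : ∀ {i j} → i ℤ.< j → ι i < ι j

-- Bounds for the Gram form over an ordered field

module GramFormBounds (F : EuclideanField) where

  open EuclideanField F
  open CommutativeRing commutativeRing hiding (zero)
  open GramForm commutativeRing ℤ⟶R
  private module ℤF = IntegralForms

  ≤-refl : ∀ {x} → x ≤ x
  ≤-refl = ≤-reflexive refl

  ≤-resp₂ : ∀ {x y u v} → x ≈ y → u ≈ v → x ≤ u → y ≤ v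
  ≤-resp₂ x≈y u≈v x≤u = ≤-trans (≤-reflexive (sym x≈y)) (≤-trans x≤u (≤-reflexive u≈v))

  ≤⇒0≤- : ∀ {x y} → x ≤ y → 0# ≤ y - x
  ≤⇒0≤- {x} x≤y = ≤-resp₂ (-‿inverseʳ x) refl (+-mono-≤ x≤y ≤-refl)

  0≤-⇒≤ : ∀ {x y} → 0# ≤ y - x → x ≤ y
  0≤-⇒≤ {x} {y} 0≤y-x = ≤-resp₂ (+-identityˡ x)
    (solve 2 (λ x y → (y :- x) :+ x := y) refl x y) (+-mono-≤ 0≤y-x ≤-refl)

  <⇒0<- : ∀ {x y} → x < y → 0# < y - x
  <⇒0<- {x} x<y = ≤-<-trans (≤-reflexive (sym (-‿inverseʳ x))) (+-monoˡ-< (- x) x<y)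

  +-pos-nonneg : ∀ {x y} → 0# < x → 0# ≤ y → 0# < x + y
  +-pos-nonneg {x} 0<x 0≤y = <-≤-trans 0<x (≤-resp₂ (+-identityʳ x) refl (+-mono-≤ ≤-refl 0≤y))

  +-nonneg : ∀ {x y} → 0# ≤ x → 0# ≤ y → 0# ≤ x + y
  +-nonneg 0≤x 0≤y = ≤-resp₂ (+-identityˡ 0#) refl (+-mono-≤ 0≤x 0≤y)

  -- Since x y = (√x √y)², closure under products follows from square-nonneg.
  *-nonneg : ∀ {x y} → 0# ≤ x → 0# ≤ y → 0# ≤ x * y
  *-nonneg {x} {y} 0≤x 0≤y = ≤-resp₂ refl
    (trans (solve 2 (λ r s → (r :* s) :* (r :* s) := (r :* r) :* (s :* s)) refl (√ x) (√ y))
      (*-cong (√-square 0≤x) (√-square 0≤y)))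
    (square-nonneg (√ x * √ y))

  *-monoˡ-≤ : ∀ {w x y} → 0# ≤ w → x ≤ y → w * x ≤ w * y
  *-monoˡ-≤ {w} {x} {y} 0≤w x≤y = 0≤-⇒≤ (≤-resp₂ refl
    (solve 3 (λ w x y → w :* (y :- x) := w :* y :- w :* x) refl w x y)
    (*-nonneg 0≤w (≤⇒0≤- x≤y)))

  square-mono-≤ : ∀ {x y} → 0# ≤ x → x ≤ y → x * x ≤ y * y
  square-mono-≤ {x} {y} 0≤x x≤y = ≤-trans (*-monoˡ-≤ 0≤x x≤y)
    (≤-resp₂ (*-comm y x) refl (*-monoˡ-≤ (≤-trans 0≤x x≤y) x≤y))

  0<1 : 0# < ι (+ 1)
  0<1 = ≤-<-trans (≤-reflexive (sym 0-homo)) (ι-mono-< (ℤ.+<+ (ℕ.s≤s ℕ.z≤n)))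

  0≤2 : 0# ≤ 2#
  0≤2 = ≤-resp₂ 0-homo refl (ι-mono-≤ (ℤ.+≤+ ℕ.z≤n))

  x+y≈0⇒x≈0 : ∀ {x y} → 0# ≤ x → 0# ≤ y → x + y ≈ 0# → x ≈ 0#
  x+y≈0⇒x≈0 {x} 0≤x 0≤y x+y≈0 =
    ≤-antisym (≤-resp₂ (+-identityʳ x) x+y≈0 (+-mono-≤ ≤-refl 0≤y)) 0≤x

  -- Cancelling squares against 0² gives x ≤ 0 and - x ≤ 0, and antisymmetry concludes.
  square≈0 : ∀ {x} → x * x ≈ 0# → x ≈ 0#
  square≈0 {x} x²≈0 = ≤-antisym (≤0 x²≈0)
    (≤-resp₂ refl (trans (+-identityˡ (- (- x))) (solve 1 (λ x → :- (:- x) := x) refl x))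
      (≤⇒0≤- (≤0 (trans (solve 1 (λ x → (:- x) :* (:- x) := x :* x) refl x) x²≈0))))
    where
    ≤0 : ∀ {y} → y * y ≈ 0# → y ≤ 0#
    ≤0 y²≈0 = square-cancel-≤ ≤-refl (≤-reflexive (trans y²≈0 (sym (zeroˡ 0#))))

  *-cancelˡ-≈0 : ∀ {w x} → 0# < w → w * x ≈ 0# → x ≈ 0#
  *-cancelˡ-≈0 {w} {x} 0<w wx≈0 with inverse 0<w
  ... | v , wv≈1 = trans (sym (trans (*-congʳ wv≈1) (*-identityˡ x)))
    (trans (solve 3 (λ w v x → w :* v :* x := v :* (w :* x)) refl w v x)
      (trans (*-congˡ wx≈0) (zeroʳ v)))

  √-mono-≤ : ∀ {x y} → 0# ≤ x → x ≤ y → √ x ≤ √ y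
  √-mono-≤ {x} {y} 0≤x x≤y = square-cancel-≤ (√-nonneg y)
    (≤-resp₂ (sym (√-square 0≤x)) (sym (√-square (≤-trans 0≤x x≤y))) x≤y)

  √-cong : ∀ {x y} → 0# ≤ x → x ≈ y → √ x ≈ √ y
  √-cong 0≤x x≈y = ≤-antisym (√-mono-≤ 0≤x (≤-reflexive x≈y))
    (√-mono-≤ (≤-resp₂ refl x≈y 0≤x) (≤-reflexive (sym x≈y)))

  √-injective : ∀ {x y} → 0# ≤ x → 0# ≤ y → √ x ≈ √ y → x ≈ y
  √-injective 0≤x 0≤y eq = trans (sym (√-square 0≤x)) (trans (*-cong eq eq) (√-square 0≤y))

  ι-injective : ∀ {i j} → ι i ≈ ι j → i ≡ j
  ι-injective {i} {j} eq with ℤₚ.<-cmp i j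
  ... | tri< i<j _ _ = contradiction (<-≤-trans (ι-mono-< i<j) (≤-reflexive (sym eq))) <-irrefl
  ... | tri≈ _ i≡j _ = i≡j
  ... | tri> _ _ j<i = contradiction (<-≤-trans (ι-mono-< j<i) (≤-reflexive eq)) <-irrefl

  sumOfSquares-nonneg : ∀ {n} (x : Vector Carrier n) → 0# ≤ sumOfSquares x
  sumOfSquares-nonneg {zero}  x = ≤-refl
  sumOfSquares-nonneg {suc n} x =
    +-nonneg (square-nonneg (x zero)) (sumOfSquares-nonneg (x ∘ suc))

  sumOfSquares≈0 : ∀ {n} (x : Vector Carrier n) → sumOfSquares x ≈ 0# → ∀ k → x k ≈ 0#
  sumOfSquares≈0 x eq zero    = square≈0
    (x+y≈0⇒x≈0 (square-nonneg (x zero)) (sumOfSquares-nonneg (x ∘ suc)) eq)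
  sumOfSquares≈0 x eq (suc k) = sumOfSquares≈0 (x ∘ suc)
    (x+y≈0⇒x≈0 (sumOfSquares-nonneg (x ∘ suc)) (square-nonneg (x zero))
      (trans (+-comm _ _) eq)) k

  -- Transport of the integral forms along ι

  ι-sum : ∀ {n} (x : Vector ℤ n) → ι (ℤF.sum x) ≈ sum (ι ∘ x)
  ι-sum {zero}  x = 0-homo
  ι-sum {suc n} x = trans (+-homo _ _) (+-congˡ (ι-sum (x ∘ suc)))

  ι-sumOfSquares : ∀ {n} (x : Vector ℤ n) → ι (ℤF.sumOfSquares x) ≈ sumOfSquares (ι ∘ x)
  ι-sumOfSquares x = trans (ι-sum (λ i → x i ℤ.* x i)) (sum-cong-≋ (λ i → *-homo (x i) (x i)))

  ι-extend : ∀ {m} (d : Vector ℤ m) k → ι (ℤF.extend d k) ≈ extend (ι ∘ d) k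
  ι-extend {zero}  d k       = 0-homo
  ι-extend {suc m} d zero    = refl
  ι-extend {suc m} d (suc k) = ι-extend (d ∘ suc) k

  ι-adjacent : ∀ {m} (d : Vector ℤ m) → ι (ℤF.adjacent d) ≈ adjacent (ι ∘ d)
  ι-adjacent {zero}  d = 0-homo
  ι-adjacent {suc m} d = trans (+-homo _ _)
    (+-cong (trans (*-homo _ _) (*-congˡ (ι-extend (d ∘ suc) 0))) (ι-adjacent (d ∘ suc)))

  ι-cross : ∀ {m} (z : Vector ℤ (3 ℕ.+ m)) → ι (ℤF.cross z) ≈ cross (ι ∘ z)
  ι-cross z = trans (+-homo _ _) (+-cong
    (trans (+-homo _ _) (+-cong
      (trans (+-homo _ _) (+-cong
        (trans (+-homo _ _) (+-cong (*-homo _ _) (*-homo _ _)))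
        (*-homo _ _)))
      (trans (*-homo _ _) (*-congˡ (ι-extend (ℤF.tail₃ z) 0)))))
    (trans (-‿homo _) (-‿cong (ι-adjacent (ℤF.tail₃ z)))))

  ι-formA : ∀ {m} (z : Vector ℤ (3 ℕ.+ m)) → ι (ℤF.formA z) ≈ formA (ι ∘ z)
  ι-formA z = trans (+-homo _ _) (+-cong (ι-sumOfSquares z) (ι-cross z))

  ι-formD : ∀ {m} (z : Vector ℤ (3 ℕ.+ m)) → ι (ℤF.formD z) ≈ formD (ι ∘ z)
  ι-formD z = trans (+-homo _ _) (+-cong (ι-formA z)
    (trans (*-homo _ _) (*-congˡ (ι-extend (ℤF.tail₃ z) 0))))

  -- Weights, lower bound and equality case

  module _ {a c : Carrier} (1<a : ι (+ 1) < a) (0≤c : 0# ≤ c)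
           (a²+c²≈2 : a * a + c * c ≈ 2#) where

    0<a : 0# < a
    0<a = <-≤-trans 0<1 (<⇒≤ 1<a)

    1≤a² : ι (+ 1) ≤ a * a
    1≤a² = ≤-resp₂ (solve 0 (con (+ 1) :* con (+ 1) := con (+ 1)) refl) refl
      (square-mono-≤ (<⇒≤ 0<1) (<⇒≤ 1<a))

    -- By a² + c² = 2, the difference a² - c² equals 2 (a² - 1), which is nonnegative.
    c≤a : c ≤ a
    c≤a = square-cancel-≤ (<⇒≤ 0<a) (0≤-⇒≤ (≤-resp₂ refl
      (trans (solve 1 (λ s → (s :- con (+ 1)) :+ (s :- con (+ 1)) := (s :+ s) :- con (+ 2))
          refl (a * a))
        (trans (+-congˡ (-‿cong (sym a²+c²≈2)))
          (solve 2 (λ s t → (s :+ s) :- (s :+ t) := s :- t) refl (a * a) (c * c))))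
      (+-nonneg (≤⇒0≤- 1≤a²) (≤⇒0≤- 1≤a²))))

    0≤ac-c² : 0# ≤ a * c - c * c
    0≤ac-c² = ≤-resp₂ refl
      (solve 2 (λ a c → c :* (a :- c) := a :* c :- c :* c) refl a c)
      (*-nonneg 0≤c (≤⇒0≤- c≤a))

    weight₀ weight₁ weight₂ : Carrier
    weight₀ = 2# * (ι (+ 1) - a * c)
    weight₁ = 2# * (a * c - c * c)
    weight₂ = 2# * (c * c)

    weight₁-nonneg : 0# ≤ weight₁
    weight₁-nonneg = *-nonneg 0≤2 0≤ac-c²

    weight₂-nonneg : 0# ≤ weight₂
    weight₂-nonneg = *-nonneg 0≤2 (square-nonneg c)

    -- 2 (1 - ac) = (a² - 1)² + (1 - ac)² when a² + c² = 2.
    weight₀-pos : 0# < weight₀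
    weight₀-pos = <-≤-trans (*-pos 0<a²-1 0<a²-1) (0≤-⇒≤ (≤-resp₂ refl
      (trans
        (solve 2 (λ a c →
          (con (+ 1) :- a :* c) :* (con (+ 1) :- a :* c)
          := con (+ 2) :* (con (+ 1) :- a :* c) :- ((a :* a :- con (+ 1)) :* (a :* a :- con (+ 1))
            :- (a :* a) :* (a :* a :+ c :* c :- con (+ 2)))) refl a c)
        (+-congˡ (-‿cong (trans
          (+-congˡ (-‿cong (*-congˡ (trans (+-congʳ a²+c²≈2) (-‿inverseʳ 2#)))))
          (trans (+-congˡ (-‿cong (zeroʳ (a * a))))
            (trans (+-congˡ (-‿cong (sym 0-homo)))
              (solve 1 (λ x → x :- con (+ 0) := x) refl _)))))))
      (square-nonneg (ι (+ 1) - a * c))))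
      where
      0<a²-1 : 0# < a * a - ι (+ 1)
      0<a²-1 = <-≤-trans (*-pos (<⇒0<- 1<a) (+-pos-nonneg 0<a (<⇒≤ 0<1)))
        (≤-reflexive (solve 1 (λ a → (a :- con (+ 1)) :* (a :+ con (+ 1)) := a :* a :- con (+ 1))
          refl a))

    weights≈2 : weight₀ + weight₁ + weight₂ ≈ 2#
    weights≈2 = solve 2 (λ a c → con (+ 2) :* (con (+ 1) :- a :* c)
      :+ con (+ 2) :* (a :* c :- c :* c) :+ con (+ 2) :* (c :* c) := con (+ 2)) refl a c

    -- For real z the forms A and D are merely nonnegative, but `weight₀` is positive, so the
    -- summand with Σ zᵢ² alone forces z to vanish.
    image-injective : ∀ {m} (z : Vector Carrier (3 ℕ.+ m)) →
      (∀ k → image a c z k ≈ 0#) → ∀ k → z k ≈ 0#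
    image-injective z eq = sumOfSquares≈0 z (*-cancelˡ-≈0 weight₀-pos
      (x+y≈0⇒x≈0 (*-nonneg (<⇒≤ weight₀-pos) (sumOfSquares-nonneg z))
        (+-nonneg
          (double-nonneg (sumOfSquares-squaresA z) (sumOfSquares-nonneg (squaresA z)) 0≤ac-c²)
          (double-nonneg (sumOfSquares-squaresD z) (sumOfSquares-nonneg (squaresD z))
            (square-nonneg c)))
        (trans (sym (+-assoc _ _ _)) (trans (sym (gram-convex a c z a²+c²≈2))
          (sum-zero (λ k → trans (*-congʳ (eq k)) (zeroˡ (image a c z k))))))))
      where
      -- The factor 2 of the weight turns the form into its sum of squares, so nothing has to be
      -- halved.
      double-nonneg : ∀ {s x w} → s ≈ 2# * x → 0# ≤ s → 0# ≤ w → 0# ≤ 2# * w * x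
      double-nonneg {x = x} {w} s≈2x 0≤s 0≤w = ≤-resp₂ refl
        (trans (*-congˡ s≈2x)
          (solve 2 (λ w x → w :* (con (+ 2) :* x) := con (+ 2) :* w :* x) refl w x))
        (*-nonneg 0≤w 0≤s)

    -- All three forms equal 1 at a signed unit vector, which leaves the sum of the weights.
    gram-unit : ∀ {m} σ (i : Fin (3 ℕ.+ m)) →
      sumOfSquares (image a c (ι ∘ ℤF.unit σ i)) ≈ 2#
    gram-unit σ i = trans (gram-convex a c (ι ∘ z) a²+c²≈2) (trans
      (+-cong (+-cong (times1 (ι-sumOfSquares z) (ℤF.sumOfSquares-unit σ i))
        (times1 (ι-formA z) (ℤF.formA-unit σ i))) (times1 (ι-formD z) (ℤF.formD-unit σ i)))
      weights≈2)
      where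
      z = ℤF.unit σ i
      times1 : ∀ {w i x} → ι i ≈ x → i ≡ + 1 → w * x ≈ w
      times1 {w} ιi≈x ≡.refl = trans (*-congˡ (trans (sym ιi≈x) 1-homo)) (*-identityʳ w)

    module _ {m} (z : Vector ℤ (3 ℕ.+ m)) (z≢0 : ¬ (∀ k → z k ≡ + 0)) where

      private
        -- The case r = 1 gives the minimum; r = 2 gives the strict excess in the equality case.
        lowerBound : ∀ {r} → r ℤ.≤ ℤF.sumOfSquares z →
          weight₀ * ι r + weight₁ + weight₂ ≤ sumOfSquares (image a c (ι ∘ z))
        lowerBound r≤ = ≤-resp₂ refl (sym (gram-convex a c (ι ∘ z) a²+c²≈2))
          (+-mono-≤ (+-mono-≤
            (*-monoˡ-≤ (<⇒≤ weight₀-pos) (≤-resp₂ refl (ι-sumOfSquares z) (ι-mono-≤ r≤)))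
            (times≥1 weight₁-nonneg (ι-formA z) (ℤF.formA≥1 z z≢0)))
            (times≥1 weight₂-nonneg (ι-formD z) (ℤF.formD≥1 z z≢0)))
          where
          times≥1 : ∀ {w i x} → 0# ≤ w → ι i ≈ x → + 1 ℤ.≤ i → w ≤ w * x
          times≥1 {w} 0≤w ιi≈x 1≤i = ≤-resp₂ (trans (*-congˡ 1-homo) (*-identityʳ w)) refl
            (*-monoˡ-≤ 0≤w (≤-resp₂ refl ιi≈x (ι-mono-≤ 1≤i)))

      gram≥2 : 2# ≤ sumOfSquares (image a c (ι ∘ z))
      gram≥2 = ≤-resp₂
        (trans (+-congʳ (+-congʳ (trans (*-congˡ 1-homo) (*-identityʳ weight₀)))) weights≈2)
        refl (lowerBound (ℤF.sumOfSquares≥1 z z≢0))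

      gram≈2⇒unit : sumOfSquares (image a c (ι ∘ z)) ≈ 2# →
                    ∃[ σ ] ∃[ i ] (∀ k → z k ≡ ℤF.unit σ i k)
      gram≈2⇒unit eq with ℤF.size z
      ... | ℤF.isZero z≡0     = contradiction z≡0 z≢0
      ... | ℤF.isUnit σ i z≡u = σ , i , z≡u
      -- With r = 2 the lower bound becomes `weight₀` + 2, which exceeds 2.
      ... | ℤF.isBig 2≤Σ      = contradiction
        (<-≤-trans 2<2+weight₀ (≤-resp₂
          (trans (solve 3 (λ p q r → p :* con (+ 2) :+ q :+ r := p :+ (p :+ q :+ r))
            refl weight₀ weight₁ weight₂) (+-congˡ weights≈2)) eq (lowerBound 2≤Σ)))
        <-irrefl
        where
        2<2+weight₀ : 2# < weight₀ + 2#
        2<2+weight₀ = ≤-<-trans (≤-reflexive (sym (+-identityˡ 2#))) (+-monoˡ-< 2# weight₀-pos)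

    -- Back substitution from the last entry: each new entry solves c e - a x = w₀, with e the entry
    -- already found after it and v = 1/a.
    steps-surjective : ∀ {m} (w : Vector Carrier m) →
      Σ[ d ∈ Vector Carrier m ] (∀ k → steps a c d k ≈ w k)
    steps-surjective {zero}  w = w , λ ()
    steps-surjective {suc m} w with steps-surjective (w ∘ suc) | inverse 0<a
    ... | d , eq | v , av≈1 = d′ , λ where
        zero    → trans
          (solve 5 (λ c e a v w → c :* e :- a :* (v :* (c :* e :- w))
            := c :* e :- (a :* v) :* (c :* e :- w)) refl c e a v (w zero))
          (trans (+-congˡ (-‿cong (trans (*-congʳ av≈1) (*-identityˡ _))))
            (solve 2 (λ x w → x :- (x :- w) := w) refl (c * e) (w zero)))
        (suc k) → eq k
      where
      e = extend d 0
      d′ : Vector Carrier (suc m)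
      d′ zero    = v * (c * e - w zero)
      d′ (suc k) = d k

    -- The system is triangular apart from the leading circulant block, which
    -- has determinant a³ + c³.
    image-surjective : ∀ {m} (y : Vector Carrier (3 ℕ.+ m)) →
      Σ[ z ∈ Vector Carrier (3 ℕ.+ m) ] (∀ k → image a c z k ≈ y k)
    image-surjective {m} y
      with steps-surjective (tail₃ y)
         | inverse (+-pos-nonneg (*-pos 0<a (*-pos 0<a 0<a)) (*-nonneg 0≤c (square-nonneg c)))
    ... | d , eq | v , Δv≈1 = z , λ where
        zero                → solved
          (solve 6 (λ a c v p q r → a :* (v :* (a :* a :* p :+ c :* c :* q :- a :* c :* r))
              :+ c :* (v :* (a :* a :* r :+ c :* c :* p :- a :* c :* q))
            := (a :* (a :* a) :+ c :* (c :* c)) :* v :* p) refl a c v p q r)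
        (suc zero)          → solved
          (solve 6 (λ a c v p q r → c :* (v :* (a :* a :* p :+ c :* c :* q :- a :* c :* r))
              :+ a :* (v :* (a :* a :* q :+ c :* c :* r :- a :* c :* p))
            := (a :* (a :* a) :+ c :* (c :* c)) :* v :* q) refl a c v p q r)
        (suc (suc zero))    → trans
          (+-congʳ (solved
            (solve 6 (λ a c v p q r → c :* (v :* (a :* a :* q :+ c :* c :* r :- a :* c :* p))
                :+ a :* (v :* (a :* a :* r :+ c :* c :* p :- a :* c :* q))
              := (a :* (a :* a) :+ c :* (c :* c)) :* v :* r) refl a c v p q r)))
          (solve 2 (λ y x → y :- x :+ x := y) refl (y (suc (suc zero))) (c * extend d 0))
        (suc (suc (suc k))) → eq k
      where
      p = y zero
      q = y (suc zero)
      -- The tail is already known, so its share of the third coordinate is subtracted first.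
      r = y (suc (suc zero)) - c * extend d 0
      z : Vector Carrier (3 ℕ.+ m)
      -- The rows of the adjugate of the leading block, with v the inverse of the determinant.
      z zero                = v * (a * a * p + c * c * q - a * c * r)
      z (suc zero)          = v * (a * a * q + c * c * r - a * c * p)
      z (suc (suc zero))    = v * (a * a * r + c * c * p - a * c * q)
      z (suc (suc (suc k))) = d k
      solved : ∀ {x y} → x ≈ (a * (a * a) + c * (c * c)) * v * y → x ≈ y
      solved {y = y} x≈ = trans x≈ (trans (*-congʳ Δv≈1) (*-identityˡ y))

  -- Over ℝ this and `norm` unfold to `linearCombination` and `‖_‖`.
  combination : ∀ {m n} → Vector Carrier m → Vector (Vector Carrier n) m → Vector Carrier n
  combination z b j = sum (λ i → z i * b i j)

  norm : ∀ {n} → Vector Carrier n → Carrier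
  norm x = √ (sumOfSquares x)

  norm≈√2⇒sumOfSquares≈2 : ∀ {n} (x : Vector Carrier n) → norm x ≈ √ 2# → sumOfSquares x ≈ 2#
  norm≈√2⇒sumOfSquares≈2 x = √-injective (sumOfSquares-nonneg x) 0≤2

  norm≈√2⇒≉0 : ∀ {n} (x : Vector Carrier n) → norm x ≈ √ 2# → ¬ (∀ k → x k ≈ 0#)
  norm≈√2⇒≉0 x norm≈ x≈0 = contradiction (ι-injective (trans
      (sym (norm≈√2⇒sumOfSquares≈2 x norm≈))
      (trans (sum-zero (λ k → trans (*-congʳ (x≈0 k)) (zeroˡ (x k)))) (sym 0-homo))))
    λ ()

  sum-*-cong : ∀ {n} {x y : Vector Carrier n} (w : Vector Carrier n) → (∀ k → x k ≈ y k) →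
               sum (λ k → x k * w k) ≈ sum (λ k → y k * w k)
  sum-*-cong w x≈y = sum-cong-≋ (λ k → *-congʳ (x≈y k))

  sum-*-difference : ∀ {n} (x y w : Vector Carrier n) →
    sum (λ k → (x k - y k) * w k) ≈ sum (λ k → x k * w k) - sum (λ k → y k * w k)
  sum-*-difference {zero}  x y w = sym (-‿inverseʳ 0#)
  sum-*-difference {suc n} x y w = trans
    (+-congˡ (sum-*-difference (x ∘ suc) (y ∘ suc) (w ∘ suc)))
    (solve 5 (λ x y w s t → (x :- y) :* w :+ (s :- t) := (x :* w :+ s) :- (y :* w :+ t))
      refl (x zero) (y zero) (w zero)
      (sum (λ k → x (suc k) * w (suc k))) (sum (λ k → y (suc k) * w (suc k))))

  sum-single : ∀ {n} (i : Fin n) s (w : Vector Carrier n) →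
    sum (λ k → ι (ℤF.single i s k) * w k) ≈ ι s * w i
  sum-single {suc n} zero s w = trans
    (+-congˡ (sum-zero (λ k → trans (*-congʳ 0-homo) (zeroˡ (w (suc k))))))
    (+-identityʳ (ι s * w zero))
  sum-single {suc n} (suc i) s w = trans
    (+-cong (trans (*-congʳ 0-homo) (zeroˡ (w zero))) (sum-single i s (w ∘ suc)))
    (+-identityˡ (ι s * w (suc i)))

  -- The bound a ≤ √2 makes the radicand 2 - a² nonnegative, as `√-square` requires.
  square-complement : ∀ {a} → ι (+ 1) < a → a ≤ √ 2# → a * a + √ (2# - a * a) * √ (2# - a * a) ≈ 2#
  square-complement {a} 1<a a≤√2 = trans (+-congˡ (√-square (≤⇒0≤- (≤-resp₂ refl (√-square 0≤2)
      (square-mono-≤ (≤-trans (<⇒≤ 0<1) (<⇒≤ 1<a)) a≤√2)))))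
    (solve 2 (λ s t → s :+ (t :- s) := t) refl (a * a) 2#)

  -- Signed basis vectors as the minimal vectors

  module WellRoundedBasis {a c : Carrier} (1<a : ι (+ 1) < a) (0≤c : 0# ≤ c)
    (a²+c²≈2 : a * a + c * c ≈ 2#) {m : ℕ}
    (b : Vector (Vector Carrier (3 ℕ.+ m)) (3 ℕ.+ m))
    (b-image : ∀ z j → combination z b j ≈ image a c z j) where

    private n = 3 ℕ.+ m

    signed : Fin 2 → Fin n → Vector Carrier n
    signed zero       i   = b i
    signed (suc zero) i j = - b i j

    combination-unit : ∀ σ i j → combination (ι ∘ ℤF.unit σ i) b j ≈ signed σ i j
    combination-unit σ i j = trans (sum-single i (ℤF.sign σ) (λ k → b k j)) (scale σ)
      where
      scale : ∀ σ → ι (ℤF.sign σ) * b i j ≈ signed σ i j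
      scale zero       = solve 1 (λ x → con (+ 1) :* x := x) refl (b i j)
      scale (suc zero) = solve 1 (λ x → con -[1+ 0 ] :* x := :- x) refl (b i j)

    independent : ∀ z → (∀ j → combination z b j ≈ 0#) → ∀ i → z i ≈ 0#
    independent z eq =
      image-injective 1<a 0≤c a²+c²≈2 z (λ j → trans (sym (b-image z j)) (eq j))

    spanning : ∀ y → Σ[ z ∈ Vector Carrier n ] (∀ j → y j ≈ combination z b j)
    spanning y with image-surjective 1<a 0≤c a²+c²≈2 y
    ... | z , eq = z , λ j → sym (trans (b-image z j) (eq j))

    -- Equal signed vectors give a linear relation among the bᵢ whose coefficients are the
    -- difference of two unit vectors; by independence the unit vectors agree. Hence the count is
    -- exactly 2n.
    signed-injective : ∀ {σ τ i j} → (∀ k → signed σ i k ≈ signed τ j k) → (σ , i) ≡ (τ , j)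
    signed-injective {σ} {τ} {i} {j} eq = ℤF.unit-injective λ k → ι-injective
      (trans (solve 2 (λ x y → x := (x :- y) :+ y) refl (u k) (v k))
        (trans (+-congʳ (independent (λ k → u k - v k) difference≈0 k)) (+-identityˡ (v k))))
      where
      u = ι ∘ ℤF.unit σ i
      v = ι ∘ ℤF.unit τ j
      difference≈0 : ∀ l → combination (λ k → u k - v k) b l ≈ 0#
      difference≈0 l = trans (sum-*-difference u v (λ k → b k l)) (trans
        (+-congʳ (trans (combination-unit σ i l) (trans (eq l) (sym (combination-unit τ j l)))))
        (-‿inverseʳ (combination v b l)))

    ≈signed⇒norm≈√2 : ∀ {x} σ i → (∀ j → x j ≈ signed σ i j) → norm x ≈ √ 2#
    ≈signed⇒norm≈√2 {x} σ i x≈ = √-cong (sumOfSquares-nonneg x) (trans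
      (sumOfSquares-cong (λ j → trans (x≈ j)
        (trans (sym (combination-unit σ i j)) (b-image (ι ∘ ℤF.unit σ i) j))))
      (gram-unit 1<a 0≤c a²+c²≈2 σ i))

    module _ (z : Vector ℤ n) (x : Vector Carrier n)
             (x≈ : ∀ j → x j ≈ combination (ι ∘ z) b j) where

      private
        gram≈ : sumOfSquares x ≈ sumOfSquares (image a c (ι ∘ z))
        gram≈ = sumOfSquares-cong (λ j → trans (x≈ j) (b-image (ι ∘ z) j))

        z≢0 : ¬ (∀ k → x k ≈ 0#) → ¬ (∀ k → z k ≡ + 0)
        z≢0 x≉0 z≡0 = x≉0 λ j → trans (x≈ j) (sum-zero λ k →
          trans (*-congʳ (trans (reflexive (≡.cong ι (z≡0 k))) 0-homo)) (zeroˡ (b k j)))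

      norm≥√2 : ¬ (∀ k → x k ≈ 0#) → √ 2# ≤ norm x
      norm≥√2 x≉0 = √-mono-≤ 0≤2
        (≤-resp₂ refl (sym gram≈) (gram≥2 1<a 0≤c a²+c²≈2 z (z≢0 x≉0)))

      norm≈√2⇒signed : norm x ≈ √ 2# → ∃[ σ ] ∃[ i ] (∀ j → x j ≈ signed σ i j)
      norm≈√2⇒signed norm≈
        with gram≈2⇒unit 1<a 0≤c a²+c²≈2 z (z≢0 (norm≈√2⇒≉0 x norm≈))
               (trans (sym gram≈) (norm≈√2⇒sumOfSquares≈2 x norm≈))
      ... | σ , i , z≡ = σ , i , λ j → trans (x≈ j) (trans
        (sum-*-cong (λ k → b k j) (λ k → reflexive (≡.cong ι (z≡ k))))
        (combination-unit σ i j))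

-- The Cauchy reals

open import Defs

module RealField where

  open ≡ using (refl; sym; trans; cong; cong₂; subst; subst₂)
  open RationalLemmas
  open RationalRoot using (√≈; √≈-nonneg; √≈-lower; √≈-upper)
  open CauchyLemmas using (isCauchy⇒bounded)
  open +-*-Solver using (solve; _:+_; _:*_; :-_; _:-_; _:=_; con)

  Eventually : (ℕ → Set) → Set
  Eventually P = ∃[ N ] (∀ n → N ℕ.≤ n → P n)

  always : ∀ {P : ℕ → Set} → (∀ n → P n) → Eventually P
  always p = 0 , λ n _ → p n

  map : ∀ {P Q : ℕ → Set} → (∀ n → P n → Q n) → Eventually P → Eventually Q
  map f (N , p) = N , λ n n≥ → f n (p n n≥)

  zipWith : ∀ {P Q R : ℕ → Set} → (∀ n → P n → Q n → R n) →
            Eventually P → Eventually Q → Eventually R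
  zipWith f (M , p) (N , q) = M ℕ.⊔ N , λ n n≥ →
    f n (p n (ℕₚ.m⊔n≤o⇒m≤o M N n≥)) (q n (ℕₚ.m⊔n≤o⇒n≤o M N n≥))

  *-posℚ : ∀ {p q} → 0ℚ ℚ.< p → 0ℚ ℚ.< q → 0ℚ ℚ.< p ℚ.* q
  *-posℚ {p} {q} 0<p 0<q =
    ℚₚ.positive⁻¹ (p ℚ.* q) {{ℚₚ.pos*pos⇒pos p {{ℚ.positive 0<p}} q {{ℚ.positive 0<q}}}}

  p<p+ε : ∀ p {ε} → 0ℚ ℚ.< ε → p ℚ.< p ℚ.+ ε
  p<p+ε p 0<ε = subst (ℚ._< p ℚ.+ _) (ℚₚ.+-identityʳ p) (ℚₚ.+-monoʳ-< p 0<ε)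

  0≤p*p : ∀ p → 0ℚ ℚ.≤ p ℚ.* p
  0≤p*p p = subst (0ℚ ℚ.≤_) ∣p∣²≡p² (square-mono {0ℚ} {∣ p ∣} ℚₚ.≤-refl (ℚₚ.0≤∣p∣ p))
    where
    ∣p∣²≡p² : ∣ p ∣ ℚ.* ∣ p ∣ ≡ p ℚ.* p
    ∣p∣²≡p² with ℚₚ.∣p∣≡p∨∣p∣≡-p p
    ... | inj₁ eq = cong₂ ℚ._*_ eq eq
    ... | inj₂ eq = trans (cong₂ ℚ._*_ eq eq)
      (solve 1 (λ p → (:- p) :* (:- p) := p :* p) refl p)

  -- The ring operations act termwise, so the ring laws are inherited from ℚ index by index.
  pointwise : ∀ x y → (∀ n → seq x n ≡ seq y n) → x ≃ y
  pointwise x y eq ε 0<ε = always λ n →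
    subst (λ q → ∣ seq x n ℚ.- q ∣ ℚ.< ε) (eq n)
      (subst (ℚ._< ε) (sym (∣p-p∣≡0 (seq x n))) 0<ε)

  +-cong-≃ : ∀ {x y u v} → x ≃ y → u ≃ v → x + u ≃ y + v
  +-cong-≃ {x} {y} {u} {v} x≃y u≃v ε 0<ε = zipWith
    (λ n xy uv → ℚₚ.≤-<-trans (∣+-∣ (seq x n) (seq u n) (seq y n) (seq v n))
      (halves {ε = ε} xy uv))
    (x≃y (½ ℚ.* ε) (½-pos 0<ε)) (u≃v (½ ℚ.* ε) (½-pos 0<ε))

  neg-cong-≃ : ∀ {x y} → x ≃ y → - x ≃ - y
  neg-cong-≃ {x} {y} x≃y ε 0<ε =
    map (λ n → subst (ℚ._< ε) (sym (∣neg∣ (seq x n) (seq y n)))) (x≃y ε 0<ε)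

  -- The difference is x (u - v) + v (x - y), hence the bounds on x and v.
  *-cong-≃ : ∀ {x y u v} → x ≃ y → u ≃ v → x * u ≃ y * v
  *-cong-≃ {x} {y} {u} {v} x≃y u≃v ε 0<ε =
    let A , 0<A , x≤A     = isCauchy⇒bounded (seq x) (cauchy x)
        B , 0<B , v≤B     = isCauchy⇒bounded (seq v) (cauchy v)
        δ₁ , 0<δ₁ , eq₁   = fraction 0<A (½-pos (½-pos 0<ε))
        δ₂ , 0<δ₂ , eq₂   = fraction 0<B (½-pos (½-pos 0<ε))
    in zipWith (λ n (x≤ , v≤) (xy , uv) →
         product-close {seq x n} {seq u n} {seq y n} {seq v n} {A} {B} {δ₁} {δ₂} {ε}
           x≤ v≤ eq₁ eq₂ 0<ε uv xy)
       (zipWith (λ _ → _,_) x≤A v≤B) (zipWith (λ _ → _,_) (x≃y δ₂ 0<δ₂) (u≃v δ₁ 0<δ₁))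

  ℝ-commutativeRing : CommutativeRing 0ℓ 0ℓ
  ℝ-commutativeRing = record
    { Carrier = ℝ
    ; _≈_ = _≃_
    ; _+_ = _+_
    ; _*_ = _*_
    ; -_ = -_
    ; 0# = 0ℝ
    ; 1# = 1ℝ
    ; isCommutativeRing = record
      { isRing = record
        { +-isAbelianGroup = record
          { isGroup = record
            { isMonoid = record
              { isSemigroup = record
                { isMagma = record
                  { isEquivalence = record
                    { refl  = λ {x} → ≃-refl {x}
                    ; sym   = λ {x} {y} → ≃-sym {x} {y}
                    ; trans = λ {x} {y} {z} → ≃-trans {x} {y} {z}
                    }
                  ; ∙-cong = λ {x} {y} {u} {v} → +-cong-≃ {x} {y} {u} {v}
                  }
                ; assoc = λ x y z → pointwise ((x + y) + z) (x + (y + z))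
                    (λ n → ℚₚ.+-assoc (seq x n) (seq y n) (seq z n))
                }
              ; identity =
                  (λ x → pointwise (0ℝ + x) x (λ n → ℚₚ.+-identityˡ (seq x n))) ,
                  (λ x → pointwise (x + 0ℝ) x (λ n → ℚₚ.+-identityʳ (seq x n)))
              }
            ; inverse =
                (λ x → pointwise (- x + x) 0ℝ (λ n → ℚₚ.+-inverseˡ (seq x n))) ,
                (λ x → pointwise (x - x) 0ℝ (λ n → ℚₚ.+-inverseʳ (seq x n)))
            ; ⁻¹-cong = λ {x} {y} → neg-cong-≃ {x} {y}
            }
          ; comm = λ x y → pointwise (x + y) (y + x) (λ n → ℚₚ.+-comm (seq x n) (seq y n))
          }
        ; *-cong = λ {x} {y} {u} {v} → *-cong-≃ {x} {y} {u} {v}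
        ; *-assoc = λ x y z → pointwise ((x * y) * z) (x * (y * z))
            (λ n → ℚₚ.*-assoc (seq x n) (seq y n) (seq z n))
        ; *-identity =
            (λ x → pointwise (1ℝ * x) x (λ n → ℚₚ.*-identityˡ (seq x n))) ,
            (λ x → pointwise (x * 1ℝ) x (λ n → ℚₚ.*-identityʳ (seq x n)))
        ; distrib =
            (λ x y z → pointwise (x * (y + z)) (x * y + x * z)
              (λ n → ℚₚ.*-distribˡ-+ (seq x n) (seq y n) (seq z n))) ,
            (λ x y z → pointwise ((y + z) * x) (y * x + z * x)
              (λ n → ℚₚ.*-distribʳ-+ (seq x n) (seq y n) (seq z n)))
        }
      ; *-comm = λ x y → pointwise (x * y) (y * x) (λ n → ℚₚ.*-comm (seq x n) (seq y n))
      }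
    }

  /1-homo-+ : ∀ i j → (i ℤ.+ j) ℚ./ 1 ≡ i ℚ./ 1 ℚ.+ j ℚ./ 1
  /1-homo-+ i j = trans
    (ℚₚ.fromℚᵘ-cong {ℚᵘ.mkℚᵘ (i ℤ.+ j) 0} {ℚᵘ.mkℚᵘ i 0 ℚᵘ.+ ℚᵘ.mkℚᵘ j 0}
      (ℚᵘ.*≡* (cong (ℤ._* + 1)
        (sym (cong₂ ℤ._+_ (ℤₚ.*-identityʳ i) (ℤₚ.*-identityʳ j))))))
    (fromℚᵘ-homo-+ (ℚᵘ.mkℚᵘ i 0) (ℚᵘ.mkℚᵘ j 0))

  /1-homo-* : ∀ i j → (i ℤ.* j) ℚ./ 1 ≡ (i ℚ./ 1) ℚ.* (j ℚ./ 1)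
  /1-homo-* i j = fromℚᵘ-homo-* (ℚᵘ.mkℚᵘ i 0) (ℚᵘ.mkℚᵘ j 0)

  /1-homo-neg : ∀ i → (ℤ.- i) ℚ./ 1 ≡ ℚ.- (i ℚ./ 1)
  /1-homo-neg i = trans
    (solve 2 (λ p q → p := (p :+ q) :- q) refl ((ℤ.- i) ℚ./ 1) (i ℚ./ 1))
    (trans (cong (ℚ._- (i ℚ./ 1)) (trans (sym (/1-homo-+ (ℤ.- i) i))
        (cong (ℚ._/ 1) (ℤₚ.+-inverseˡ i))))
      (ℚₚ.+-identityˡ (ℚ.- (i ℚ./ 1))))

  /1-mono-≤ : ∀ {i j} → i ℤ.≤ j → i ℚ./ 1 ℚ.≤ j ℚ./ 1
  /1-mono-≤ {i} {j} i≤j = fromℚᵘ-mono-≤ {ℚᵘ.mkℚᵘ i 0} {ℚᵘ.mkℚᵘ j 0}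
    (ℚᵘ.*≤* (ℤₚ.*-monoʳ-≤-nonNeg (+ 1) i≤j))

  ℤ⟶ℝ : ℤ-Morphism ℝ-commutativeRing
  ℤ⟶ℝ = record
    { ⟦_⟧    = fromℤ
    ; +-homo = λ i j → pointwise (fromℤ (i ℤ.+ j)) (fromℤ i + fromℤ j) (λ _ → /1-homo-+ i j)
    ; *-homo = λ i j → pointwise (fromℤ (i ℤ.* j)) (fromℤ i * fromℤ j) (λ _ → /1-homo-* i j)
    ; -‿homo = λ i → pointwise (fromℤ (ℤ.- i)) (- fromℤ i) (λ _ → /1-homo-neg i)
    ; 0-homo = ≃-refl {0ℝ}
    ; 1-homo = ≃-refl {1ℝ}
    }

  fromℤ-mono-≤ : ∀ {i j} → i ℤ.≤ j → fromℤ i ≤ fromℤ j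
  fromℤ-mono-≤ {i} {j} i≤j ε 0<ε =
    always λ _ → ℚₚ.≤-<-trans (/1-mono-≤ i≤j) (p<p+ε (j ℚ./ 1) 0<ε)

  fromℤ-mono-< : ∀ {i j} → i ℤ.< j → fromℤ i < fromℤ j
  -- Distinct integers differ by at least 1, so ½ separates them strictly at every index.
  fromℤ-mono-< {i} {j} i<j = ½ , ℚₚ.positive⁻¹ ½ , always λ _ →
    ℚₚ.<-≤-trans (ℚₚ.+-monoʳ-< (i ℚ./ 1) {½} {1ℚ} ½<1)
      (ℚₚ.≤-trans (ℚₚ.≤-reflexive (trans (ℚₚ.+-comm (i ℚ./ 1) 1ℚ) (sym (/1-homo-+ (+ 1) i))))
        (/1-mono-≤ (ℤₚ.i<j⇒suc[i]≤j i<j)))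
    where
    ½<1 : ½ ℚ.< 1ℚ
    ½<1 = p<p+ε ½ (ℚₚ.positive⁻¹ ½)

  ≤-reflexive-≃ : ∀ {x y} → x ≃ y → x ≤ y
  ≤-reflexive-≃ {x} {y} x≃y ε 0<ε =
    map (λ n → ∣∣<-elim {seq x n} {seq y n} {ε}) (x≃y ε 0<ε)

  ≤-transℝ : ∀ {x y z} → x ≤ y → y ≤ z → x ≤ z
  ≤-transℝ {x} {y} {z} x≤y y≤z ε 0<ε = zipWith
    (λ n xy yz → ℚₚ.<-trans xy (subst (seq y n ℚ.+ ½ ℚ.* ε ℚ.<_)
      (trans (ℚₚ.+-assoc (seq z n) (½ ℚ.* ε) (½ ℚ.* ε)) (cong (seq z n ℚ.+_) (½+½ ε)))
      (ℚₚ.+-monoˡ-< (½ ℚ.* ε) yz)))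
    (x≤y (½ ℚ.* ε) (½-pos 0<ε)) (y≤z (½ ℚ.* ε) (½-pos 0<ε))

  ≤-antisymℝ : ∀ {x y} → x ≤ y → y ≤ x → x ≃ y
  ≤-antisymℝ {x} {y} x≤y y≤x ε 0<ε =
    zipWith (λ n → ∣∣<-intro {seq x n} {seq y n} {ε}) (x≤y ε 0<ε) (y≤x ε 0<ε)

  +-mono-≤ℝ : ∀ {x y u v} → x ≤ y → u ≤ v → x + u ≤ y + v
  +-mono-≤ℝ {x} {y} {u} {v} x≤y u≤v ε 0<ε = zipWith
    (λ n xy uv → subst (seq x n ℚ.+ seq u n ℚ.<_)
      (trans
        (solve 3 (λ y v h → (y :+ h) :+ (v :+ h) := (y :+ v) :+ (h :+ h))
          refl (seq y n) (seq v n) (½ ℚ.* ε))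
        (cong (λ t → (seq y n ℚ.+ seq v n) ℚ.+ t) (½+½ ε)))
      (ℚₚ.+-mono-< xy uv))
    (x≤y (½ ℚ.* ε) (½-pos 0<ε)) (u≤v (½ ℚ.* ε) (½-pos 0<ε))

  square-nonnegℝ : ∀ x → 0ℝ ≤ x * x
  square-nonnegℝ x ε 0<ε = always λ n →
    ℚₚ.≤-<-trans (0≤p*p (seq x n)) (p<p+ε (seq x n ℚ.* seq x n) 0<ε)

  -- With h = ε/2 and δ = ε/4 one has (q + ε)² = q² + ε h + 2 ε (q + δ). If q + ε ≤ p, then q > - δ
  -- makes p² at least q² + ε h, against the hypothesis. This fixes both tolerances.
  square-cancel-≤ℚ : ∀ {p q ε} → 0ℚ ℚ.< ε → 0ℚ ℚ.< q ℚ.+ ½ ℚ.* (½ ℚ.* ε) →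
    p ℚ.* p ℚ.< q ℚ.* q ℚ.+ ε ℚ.* (½ ℚ.* ε) → p ℚ.< q ℚ.+ ε
  square-cancel-≤ℚ {p} {q} {ε} 0<ε 0<q+δ p²< with q ℚ.+ ε ℚₚ.≤? p
  ... | no  ≰     = ℚₚ.≰⇒> ≰
  ... | yes q+ε≤p = contradiction
    (ℚₚ.<-≤-trans p²< (ℚₚ.≤-trans lower (square-mono (ℚₚ.<⇒≤ 0<q+ε) q+ε≤p)))
    (ℚₚ.<-irrefl refl)
    where
    h = ½ ℚ.* ε
    δ = ½ ℚ.* h
    0<δ = ½-pos (½-pos 0<ε)
    t≡ : q ℚ.+ ε ≡ (q ℚ.+ δ) ℚ.+ (h ℚ.+ δ)
    t≡ = trans (cong (q ℚ.+_) (trans (sym (½+½ ε)) (cong (ℚ._+ h) (sym (½+½ h)))))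
      (solve 3 (λ q d h → q :+ ((d :+ d) :+ h) := (q :+ d) :+ (h :+ d)) refl q δ h)
    0<q+ε : 0ℚ ℚ.< q ℚ.+ ε
    0<q+ε = subst₂ ℚ._<_ (ℚₚ.+-identityˡ 0ℚ) (sym t≡)
      (ℚₚ.+-mono-< 0<q+δ (subst (ℚ._< h ℚ.+ δ) (ℚₚ.+-identityˡ 0ℚ)
        (ℚₚ.+-mono-< (½-pos 0<ε) 0<δ)))
    lower : q ℚ.* q ℚ.+ ε ℚ.* h ℚ.≤ (q ℚ.+ ε) ℚ.* (q ℚ.+ ε)
    lower = subst₂ ℚ._≤_ (ℚₚ.+-identityʳ _) (identity ε (½+½ ε) (½+½ h))
      (ℚₚ.+-monoʳ-≤ (q ℚ.* q ℚ.+ ε ℚ.* h)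
        (ℚₚ.<⇒≤ (*-posℚ (*-posℚ 0<ε 0<q+δ) (ℚₚ.positive⁻¹ (1ℚ ℚ.+ 1ℚ)))))
      where
      identity : ∀ ε → h ℚ.+ h ≡ ε → δ ℚ.+ δ ≡ h →
        (q ℚ.* q ℚ.+ ε ℚ.* h) ℚ.+ ε ℚ.* (q ℚ.+ δ) ℚ.* (1ℚ ℚ.+ 1ℚ)
          ≡ (q ℚ.+ ε) ℚ.* (q ℚ.+ ε)
      identity ε refl eq = trans
        (solve 3 (λ q h d → (q :* q :+ (h :+ h) :* h)
            :+ (h :+ h) :* (q :+ d) :* (con 1ℚ :+ con 1ℚ)
          := (q :* q :+ (h :+ h) :* h) :+ (h :+ h) :* (q :+ q :+ (d :+ d))) refl q h δ)
        (trans (cong (λ t → (q ℚ.* q ℚ.+ (h ℚ.+ h) ℚ.* h) ℚ.+ (h ℚ.+ h) ℚ.* (q ℚ.+ q ℚ.+ t)) eq)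
          (solve 2 (λ q h → (q :* q :+ (h :+ h) :* h) :+ (h :+ h) :* (q :+ q :+ h)
            := (q :+ (h :+ h)) :* (q :+ (h :+ h))) refl q h))

  square-cancel-≤ℝ : ∀ {x y} → 0ℝ ≤ y → x * x ≤ y * y → x ≤ y
  square-cancel-≤ℝ {x} {y} 0≤y x²≤y² ε 0<ε = zipWith
    (λ n → square-cancel-≤ℚ {seq x n} {seq y n} 0<ε)
    (0≤y (½ ℚ.* (½ ℚ.* ε)) (½-pos (½-pos 0<ε)))
    (x²≤y² (ε ℚ.* (½ ℚ.* ε)) (*-posℚ 0<ε (½-pos 0<ε)))

  <-irreflℝ : ∀ {x} → ¬ x < x
  <-irreflℝ {x} (ε , 0<ε , N , h) = ℚₚ.<-asym (h N ℕₚ.≤-refl) (p<p+ε (seq x N) 0<ε)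

  <⇒≤ℝ : ∀ {x y} → x < y → x ≤ y
  <⇒≤ℝ {x} {y} (δ , 0<δ , x+δ<y) ε 0<ε = map
    (λ n h → ℚₚ.<-trans (p<p+ε (seq x n) 0<δ) (ℚₚ.<-trans h (p<p+ε (seq y n) 0<ε))) x+δ<y

  +½+½ : ∀ p ε → p ℚ.+ ½ ℚ.* ε ℚ.+ ½ ℚ.* ε ≡ p ℚ.+ ε
  +½+½ p ε = trans (ℚₚ.+-assoc p (½ ℚ.* ε) (½ ℚ.* ε)) (cong (p ℚ.+_) (½+½ ε))

  +-cancelʳ-<ℚ : ∀ {p q} r → p ℚ.+ r ℚ.< q ℚ.+ r → p ℚ.< q
  +-cancelʳ-<ℚ {p} {q} r h = subst₂ ℚ._<_ (cancel p) (cancel q) (ℚₚ.+-monoˡ-< (ℚ.- r) h)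
    where
    cancel : ∀ s → (s ℚ.+ r) ℚ.+ ℚ.- r ≡ s
    cancel s = solve 2 (λ s r → (s :+ r) :+ (:- r) := s) refl s r

  <-≤-transℝ : ∀ {x y z} → x < y → y ≤ z → x < z
  <-≤-transℝ {x} {y} {z} (ε , 0<ε , x+ε<y) y≤z = ½ ℚ.* ε , ½-pos 0<ε , zipWith
    (λ n xy yz → +-cancelʳ-<ℚ (½ ℚ.* ε)
      (subst (ℚ._< seq z n ℚ.+ ½ ℚ.* ε) (sym (+½+½ (seq x n) ε)) (ℚₚ.<-trans xy yz)))
    x+ε<y (y≤z (½ ℚ.* ε) (½-pos 0<ε))

  ≤-<-transℝ : ∀ {x y z} → x ≤ y → y < z → x < z
  ≤-<-transℝ {x} {y} {z} x≤y (ε , 0<ε , y+ε<z) = ½ ℚ.* ε , ½-pos 0<ε , zipWith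
    (λ n xy yz → ℚₚ.<-trans
      (subst (seq x n ℚ.+ ½ ℚ.* ε ℚ.<_) (+½+½ (seq y n) ε) (ℚₚ.+-monoˡ-< (½ ℚ.* ε) xy)) yz)
    (x≤y (½ ℚ.* ε) (½-pos 0<ε)) y+ε<z

  +-monoˡ-<ℝ : ∀ {x y} z → x < y → x + z < y + z
  +-monoˡ-<ℝ {x} {y} z (ε , 0<ε , x+ε<y) = ε , 0<ε , map
    (λ n h → subst (ℚ._< seq y n ℚ.+ seq z n)
      (solve 3 (λ x z e → (x :+ e) :+ z := (x :+ z) :+ e) refl (seq x n) (seq z n) ε)
      (ℚₚ.+-monoˡ-< (seq z n) h))
    x+ε<y

  *-posℝ : ∀ {x y} → 0ℝ < x → 0ℝ < y → 0ℝ < x * y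
  *-posℝ {x} {y} (ε , 0<ε , ε<x) (δ , 0<δ , δ<y) = ε ℚ.* δ , *-posℚ 0<ε 0<δ , zipWith
    (λ n ε<x δ<y → subst (ℚ._< seq x n ℚ.* seq y n) (sym (ℚₚ.+-identityˡ (ε ℚ.* δ)))
      (product-mono (drop0 ε<x) (drop0 δ<y)))
    ε<x δ<y
    where
    drop0 : ∀ {p q} → 0ℚ ℚ.+ p ℚ.< q → p ℚ.< q
    drop0 {p} {q} = subst (ℚ._< q) (ℚₚ.+-identityˡ p)
    product-mono : ∀ {p q} → ε ℚ.< p → δ ℚ.< q → ε ℚ.* δ ℚ.< p ℚ.* q
    product-mono {p} ε<p δ<q = ℚₚ.<-trans
      (ℚₚ.*-monoˡ-<-pos δ {{ℚ.positive 0<δ}} ε<p)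
      (ℚₚ.*-monoʳ-<-pos p {{ℚ.positive (ℚₚ.<-trans 0<ε ε<p)}} δ<q)

  recip : ∀ p → 0ℚ ℚ.< p → ℚ
  recip p 0<p = (ℚ.1/ p) {{ℚₚ.pos⇒nonZero p {{ℚ.positive 0<p}}}}

  recip-inverse : ∀ p (0<p : 0ℚ ℚ.< p) → p ℚ.* recip p 0<p ≡ 1ℚ
  recip-inverse p 0<p = ℚₚ.*-inverseʳ p {{ℚₚ.pos⇒nonZero p {{ℚ.positive 0<p}}}}

  -- Multiplying the difference of the reciprocals by pq gives q - p, and pq exceeds ε².
  recip-close : ∀ {p q ε η} (0<p : 0ℚ ℚ.< p) (0<q : 0ℚ ℚ.< q) → 0ℚ ℚ.< ε → 0ℚ ℚ.< η →
    ε ℚ.< p → ε ℚ.< q → ∣ p ℚ.- q ∣ ℚ.< η ℚ.* (ε ℚ.* ε) →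
    ∣ recip p 0<p ℚ.- recip q 0<q ∣ ℚ.< η
  recip-close {p} {q} {ε} {η} 0<p 0<q 0<ε 0<η ε<p ε<q close =
    ℚₚ.*-cancelʳ-<-nonNeg (p ℚ.* q) {{ℚ.nonNegative (ℚₚ.<⇒≤ 0<pq)}}
      (subst (ℚ._< η ℚ.* (p ℚ.* q)) difference
        (ℚₚ.<-trans close (ℚₚ.*-monoʳ-<-pos η {{ℚ.positive 0<η}} ε²<pq)))
    where
    u = recip p 0<p
    v = recip q 0<q
    0<pq = *-posℚ 0<p 0<q
    ε²<pq : ε ℚ.* ε ℚ.< p ℚ.* q
    ε²<pq = ℚₚ.<-trans (ℚₚ.*-monoˡ-<-pos ε {{ℚ.positive 0<ε}} ε<p)
      (ℚₚ.*-monoʳ-<-pos p {{ℚ.positive 0<p}} ε<q)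
    difference : ∣ p ℚ.- q ∣ ≡ ∣ u ℚ.- v ∣ ℚ.* (p ℚ.* q)
    difference = trans (∣p-q∣≡∣q-p∣ p q) (trans
      (cong ∣_∣ (sym (trans
        (solve 4 (λ u v p q → (u :- v) :* (p :* q) := (p :* u) :* q :- (q :* v) :* p)
          refl u v p q)
        (cong₂ ℚ._-_
          (trans (cong (ℚ._* q) (recip-inverse p 0<p)) (ℚₚ.*-identityˡ q))
          (trans (cong (ℚ._* p) (recip-inverse q 0<q)) (ℚₚ.*-identityˡ p))))))
      (trans (ℚₚ.∣p*q∣≡∣p∣*∣q∣ (u ℚ.- v) (p ℚ.* q))
        (cong (∣ u ℚ.- v ∣ ℚ.*_) (ℚₚ.0≤p⇒∣p∣≡p (ℚₚ.<⇒≤ 0<pq)))))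

  inverseℝ : ∀ {x} → 0ℝ < x → ∃[ y ] x * y ≃ 1ℝ
  inverseℝ {x} (ε , 0<ε , N , h) = mkℝ inverseSeq isCauchy , inverseSeq-inverse
    where
    ε<x : ∀ n → ε ℚ.< seq x (N ℕ.⊔ n)
    ε<x n = subst (ℚ._< seq x (N ℕ.⊔ n)) (ℚₚ.+-identityˡ ε)
      (h (N ℕ.⊔ n) (ℕₚ.m≤m⊔n N n))
    0<x : ∀ n → 0ℚ ℚ.< seq x (N ℕ.⊔ n)
    0<x n = ℚₚ.<-trans 0<ε (ε<x n)
    -- The first N terms of x need not be invertible, so they are skipped.
    inverseSeq : ℕ → ℚ
    inverseSeq n = recip (seq x (N ℕ.⊔ n)) (0<x n)
    isCauchy : IsCauchy inverseSeq
    isCauchy η 0<η with cauchy x (η ℚ.* (ε ℚ.* ε)) (*-posℚ 0<η (*-posℚ 0<ε 0<ε))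
    ... | M , close = M , λ m n m≥ n≥ →
      recip-close {seq x (N ℕ.⊔ m)} {seq x (N ℕ.⊔ n)} (0<x m) (0<x n) 0<ε 0<η (ε<x m) (ε<x n)
        (close (N ℕ.⊔ m) (N ℕ.⊔ n)
          (ℕₚ.≤-trans m≥ (ℕₚ.m≤n⊔m N m)) (ℕₚ.≤-trans n≥ (ℕₚ.m≤n⊔m N n)))
    inverseSeq-inverse : x * mkℝ inverseSeq isCauchy ≃ 1ℝ
    -- From index N on, `N ℕ.⊔ n` is n and the product is exactly 1.
    inverseSeq-inverse δ 0<δ = N , λ n n≥ → subst (λ t → ∣ t ℚ.- 1ℚ ∣ ℚ.< δ)
      (sym (trans (cong (λ k → seq x k ℚ.* inverseSeq n) (sym (ℕₚ.m≤n⇒m⊔n≡n n≥)))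
        (recip-inverse (seq x (N ℕ.⊔ n)) (0<x n))))
      (subst (ℚ._< δ) (sym (∣p-p∣≡0 1ℚ)) 0<δ)

  √-nonnegℝ : ∀ x → 0ℝ ≤ √ x
  √-nonnegℝ x ε 0<ε = always λ n →
    ℚₚ.≤-<-trans (√≈-nonneg (seq x n) n) (p<p+ε (√≈ (seq x n) n) 0<ε)

  -- For a term r of the root and u = 1/(n+1), the term of x is below (r + u)², which exceeds r² by
  -- (2r + u) u ≤ (2B + 1) u, where B bounds the root.
  √-squareℝ : ∀ {x} → 0ℝ ≤ x → √ x * √ x ≃ x
  √-squareℝ {x} 0≤x ε 0<ε
    with isCauchy⇒bounded (seq (√ x)) (cauchy (√ x))
  ... | B , 0<B , r≤B with fraction 0<2B+1 (½-pos 0<ε)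
    where
    0<2B+1 : 0ℚ ℚ.< (B ℚ.+ B) ℚ.+ 1ℚ
    0<2B+1 = subst (ℚ._< (B ℚ.+ B) ℚ.+ 1ℚ) (ℚₚ.+-identityˡ 0ℚ)
      (ℚₚ.+-mono-< (subst (ℚ._< B ℚ.+ B) (ℚₚ.+-identityˡ 0ℚ) (ℚₚ.+-mono-< 0<B 0<B))
        (ℚₚ.positive⁻¹ 1ℚ))
  ... | δ , 0<δ , eq with archimedean 0<δ
  ... | M , u≤δ = zipWith
      (λ n (bound , 0<x+ε) small → ∣∣<-intro {seq (√ x) n ℚ.* seq (√ x) n} {seq x n} {ε}
        (below n 0<x+ε) (above n bound small))
      (zipWith (λ _ → _,_) r≤B (0≤x ε 0<ε))
      (M , λ n M≤n → ℚₚ.≤-trans (unit-antitone M≤n) u≤δ)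
    where
    below : ∀ n → 0ℚ ℚ.< seq x n ℚ.+ ε →
            √≈ (seq x n) n ℚ.* √≈ (seq x n) n ℚ.< seq x n ℚ.+ ε
    below n 0<x+ε with √≈-lower (seq x n) n
    -- The term of x may be negative when r = 0; here 0 ≤ x keeps it above - ε.
    ... | inj₁ r≡0  = subst (λ r → r ℚ.* r ℚ.< seq x n ℚ.+ ε) (sym r≡0) 0<x+ε
    ... | inj₂ r²≤x = ℚₚ.≤-<-trans r²≤x (p<p+ε (seq x n) 0<ε)
    above : ∀ n → ∣ √≈ (seq x n) n ∣ ℚ.≤ B → unit n ℚ.≤ δ →
            seq x n ℚ.< √≈ (seq x n) n ℚ.* √≈ (seq x n) n ℚ.+ ε
    above n bound u≤δ = ℚₚ.<-trans (√≈-upper (seq x n) n)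
      (ℚₚ.≤-<-trans
        (ℚₚ.≤-reflexive (solve 2 (λ r u → (r :+ u) :* (r :+ u)
          := r :* r :+ (r :+ r :+ u) :* u) refl r u))
        (ℚₚ.+-monoʳ-< (r ℚ.* r) (ℚₚ.≤-<-trans error≤ ½ε<ε)))
      where
      r = √≈ (seq x n) n
      u = unit n
      0≤u = ℚₚ.<⇒≤ (unit-pos n)
      r≤B′ : r ℚ.≤ B
      r≤B′ = subst (ℚ._≤ B) (ℚₚ.0≤p⇒∣p∣≡p (√≈-nonneg (seq x n) n)) bound
      2r+u≤2B+1 : r ℚ.+ r ℚ.+ u ℚ.≤ B ℚ.+ B ℚ.+ 1ℚ
      2r+u≤2B+1 = ℚₚ.+-mono-≤ (ℚₚ.+-mono-≤ r≤B′ r≤B′) (unit-antitone {0} {n} ℕ.z≤n)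
      0≤2B+1 : 0ℚ ℚ.≤ B ℚ.+ B ℚ.+ 1ℚ
      0≤2B+1 = ℚₚ.+-mono-≤ {0ℚ} {B ℚ.+ B} {0ℚ} {1ℚ}
        (ℚₚ.+-mono-≤ {0ℚ} {B} {0ℚ} {B} (ℚₚ.<⇒≤ 0<B) (ℚₚ.<⇒≤ 0<B))
        (ℚₚ.<⇒≤ (ℚₚ.positive⁻¹ 1ℚ))
      error≤ : (r ℚ.+ r ℚ.+ u) ℚ.* u ℚ.≤ ½ ℚ.* ε
      error≤ = ℚₚ.≤-trans (ℚₚ.*-monoʳ-≤-nonNeg u {{ℚ.nonNegative 0≤u}} 2r+u≤2B+1)
        (subst ((B ℚ.+ B ℚ.+ 1ℚ) ℚ.* u ℚ.≤_) eq
          (ℚₚ.*-monoˡ-≤-nonNeg (B ℚ.+ B ℚ.+ 1ℚ) {{ℚ.nonNegative 0≤2B+1}} u≤δ))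
      ½ε<ε : ½ ℚ.* ε ℚ.< ε
      ½ε<ε = subst (½ ℚ.* ε ℚ.<_) (½+½ ε) (p<p+ε (½ ℚ.* ε) (½-pos 0<ε))

  ℝ-euclideanField : EuclideanField
  ℝ-euclideanField = record
    { commutativeRing = ℝ-commutativeRing
    ; ℤ⟶R             = ℤ⟶ℝ
    ; _≤_             = _≤_
    ; _<_             = _<_
    ; √               = √_
    ; ≤-reflexive     = λ {x} {y} → ≤-reflexive-≃ {x} {y}
    ; ≤-trans         = λ {x} {y} {z} → ≤-transℝ {x} {y} {z}
    ; ≤-antisym       = λ {x} {y} → ≤-antisymℝ {x} {y}
    ; +-mono-≤        = λ {x} {y} {u} {v} → +-mono-≤ℝ {x} {y} {u} {v}
    ; square-nonneg   = square-nonnegℝ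
    ; square-cancel-≤ = λ {x} {y} → square-cancel-≤ℝ {x} {y}
    ; <-irrefl        = λ {x} → <-irreflℝ {x}
    ; <⇒≤             = λ {x} {y} → <⇒≤ℝ {x} {y}
    ; <-≤-trans       = λ {x} {y} {z} → <-≤-transℝ {x} {y} {z}
    ; ≤-<-trans       = λ {x} {y} {z} → ≤-<-transℝ {x} {y} {z}
    ; +-monoˡ-<       = λ {x} {y} → +-monoˡ-<ℝ {x} {y}
    ; *-pos           = λ {x} {y} → *-posℝ {x} {y}
    ; inverse         = λ {x} → inverseℝ {x}
    ; √-nonneg        = √-nonnegℝ
    ; √-square        = λ {x} → √-squareℝ {x}
    ; ι-mono-≤        = fromℤ-mono-≤
    ; ι-mono-<        = fromℤ-mono-<
    }

-- The minimal vectors of Dₙ^α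

open RealField using (ℝ-commutativeRing; ℤ⟶ℝ; ℝ-euclideanField)

module MinimalVectors (m : ℕ) (α : ℝ) (1<α : 1ℝ < α) (α≤√2 : α ≤ √ 2ℝ) where

  open EuclideanField ℝ-euclideanField using (≤-reflexive; ≤-trans; ≤-antisym; √-nonneg)
  open GramForm ℝ-commutativeRing ℤ⟶ℝ using (combination≈image)
  open GramFormBounds ℝ-euclideanField using (norm≈√2⇒≉0; module WellRoundedBasis; square-complement)

  n : ℕ
  n = 3 ℕ.+ m

  b : Vector (Vector ℝ n) n
  b = basis n α

  open WellRoundedBasis {α} {√ (2ℝ - α * α)} 1<α (√-nonneg (2ℝ - α * α))
    (square-complement {α} 1<α α≤√2) b (combination≈image α (√ (2ℝ - α * α)))

  ±⇒signed : ∀ {x} → (± b) x → ∃[ σ ] ∃[ i ] x ≋ signed σ i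
  ±⇒signed (i , inj₁ x≋b)  = zero , i , x≋b
  ±⇒signed (i , inj₂ x≋-b) = suc zero , i , x≋-b

  signed⇒± : ∀ {x} σ i → x ≋ signed σ i → (± b) x
  signed⇒± zero       i x≋ = i , inj₁ x≋
  signed⇒± (suc zero) i x≋ = i , inj₂ x≋

  ≋signed⇒∈D : ∀ {x} σ i → x ≋ signed σ i → x ∈ D n α
  ≋signed⇒∈D {x} σ i x≋ = IntegralForms.unit σ i , λ j →
    ≃-trans {x j} {signed σ i j} {linearCombination (fromℤ ∘ IntegralForms.unit σ i) b j}
      (x≋ j)
      (≃-sym {linearCombination (fromℤ ∘ IntegralForms.unit σ i) b j} {signed σ i j}
        (combination-unit σ i j))

  isFirstMinimum : IsFirstMinimum (D n α) (√ 2ℝ)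
  isFirstMinimum =
    ( signed zero zero
    , ≋signed⇒∈D {signed zero zero} zero zero (λ j → ≃-refl {signed zero zero j})
    , norm≈√2⇒≉0 (signed zero zero) norm≃√2
    , norm≃√2
    ) , λ x (z , x≋) → norm≥√2 z x x≋
    where
    norm≃√2 : ‖ signed zero zero ‖ ≃ √ 2ℝ
    norm≃√2 = ≈signed⇒norm≈√2 {signed zero zero} zero zero (λ j → ≃-refl {signed zero zero j})

  -- `S` admits any value satisfying `IsFirstMinimum`. Two such values bound each other because each
  -- is attained at a nonzero lattice vector.
  firstMinimum≃√2 : ∀ {λ₁} → IsFirstMinimum (D n α) λ₁ → λ₁ ≃ √ 2ℝ
  firstMinimum≃√2 {λ₁} ((x , (z , x≋) , x≉0 , ‖x‖≃λ₁) , λ₁-least) =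
    let (y , y∈D , y≉0 , ‖y‖≃√2) , _ = isFirstMinimum in
    ≤-antisym {λ₁} {√ 2ℝ}
      (≤-trans {λ₁} {‖ y ‖} {√ 2ℝ} (λ₁-least y y∈D y≉0) (≤-reflexive {‖ y ‖} {√ 2ℝ} ‖y‖≃√2))
      (≤-trans {√ 2ℝ} {‖ x ‖} {λ₁} (norm≥√2 z x x≋ x≉0) (≤-reflexive {‖ x ‖} {λ₁} ‖x‖≃λ₁))

  ≋signed⇒∈S : ∀ {x} σ i → x ≋ signed σ i → x ∈ S (D n α)
  ≋signed⇒∈S {x} σ i x≋ =
    ≋signed⇒∈D {x} σ i x≋ , √ 2ℝ , isFirstMinimum , ≈signed⇒norm≈√2 {x} σ i x≋

  ∈S⇒signed : ∀ {x} → x ∈ S (D n α) → ∃[ σ ] ∃[ i ] x ≋ signed σ i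
  ∈S⇒signed {x} ((z , x≋) , λ₁ , min , ‖x‖≃λ₁) = norm≈√2⇒signed z x x≋
    (≃-trans {‖ x ‖} {λ₁} {√ 2ℝ} ‖x‖≃λ₁ (firstMinimum≃√2 {λ₁} min))

  S≐±b : S (D n α) ≐ ± b
  S≐±b = (λ {x} x∈S → let σ , i , x≋ = ∈S⇒signed {x} x∈S in signed⇒± {x} σ i x≋)
       , (λ {x} x∈± → let σ , i , x≋ = ±⇒signed {x} x∈± in ≋signed⇒∈S {x} σ i x≋)

  -- Signs are elements of `Fin 2` so that this standard bijection counts the signed vectors.
  signedIndex : Fin (2 ℕ.* n) → Fin 2 × Fin n
  signedIndex = remQuot {2} n

  enumerate : Fin (2 ℕ.* n) → Σ[ x ∈ Vector ℝ n ] S (D n α) x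
  enumerate k = let σ , i = signedIndex k in
    signed σ i , ≋signed⇒∈S {signed σ i} σ i (λ j → ≃-refl {signed σ i j})

  enumerate-injective : ∀ {k l} → proj₁ (enumerate k) ≋ proj₁ (enumerate l) → k ≡ l
  enumerate-injective {k} {l} eq = let σ , i = signedIndex k ; τ , j = signedIndex l in
    ≡.trans (≡.sym (Finₚ.combine-remQuot {2} n k))
      (≡.trans (≡.cong (uncurry combine) (signed-injective {σ} {τ} {i} {j} eq))
        (Finₚ.combine-remQuot {2} n l))

  enumerate-surjective : ∀ ((x , _) : Σ[ x ∈ Vector ℝ n ] S (D n α) x) →
    ∃[ k ] ∀ {l} → l ≡ k → proj₁ (enumerate l) ≋ x
  enumerate-surjective (x , x∈S) =
    let σ , i , x≋ = ∈S⇒signed {x} x∈S in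
    combine σ i , λ l≡ → ≡.subst (λ p → uncurry signed p ≋ x)
      (≡.sym (≡.trans (≡.cong signedIndex l≡) (Finₚ.remQuot-combine σ i)))
      (λ j → ≃-sym {x j} {signed σ i j} (x≋ j))

  D-genericWellRounded : GenericWellRounded (D n α)
  D-genericWellRounded = record
    { isLattice   = n , b , independent , id , id
    ; wellRounded = λ y → let z , y≋ = spanning y in
        n , b , z , (λ i → ≋signed⇒∈S {b i} zero i (λ j → ≃-refl {b i j})) , y≋
    ; generic     = record
      { to        = enumerate
      ; cong      = λ { {k} ≡.refl j → ≃-refl {proj₁ (enumerate k) j} }
      ; bijective = (λ {k} {l} → enumerate-injective {k} {l}) , enumerate-surjective
      }
    }

mainTheorem15 : (n : ℕ) (α : ℝ) → 3 ℕ.≤ n → 1ℝ < α → α ≤ √ 2ℝ →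
    (S (D n α) ≐ ± basis n α) ×
    (∃[ λ₁ ] IsFirstMinimum (D n α) λ₁ × λ₁ * λ₁ ≃ 2ℝ) ×
    GenericWellRounded (D n α)
mainTheorem15 _ α (ℕ.s≤s (ℕ.s≤s (ℕ.s≤s (ℕ.z≤n {m})))) 1<α α≤√2 =
  S≐±b , (√ 2ℝ , isFirstMinimum , √-square {2ℝ} 0≤2) , D-genericWellRounded
  where
  open EuclideanField ℝ-euclideanField using (√-square)
  open GramFormBounds ℝ-euclideanField using (0≤2)
  open MinimalVectors m α 1<α α≤√2
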